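{- (1) Let $m,n>3$ be integers and $p\ge 1$ an integer. If $G\in\mathcal{G}(\{2p\})$ contains no induced $K_{1,n}$ and no $K_m$, then $\operatorname{def}(G)\le (m-1)(n-3)+1$. (2) Let $n>3$ be an integer and let $A$ be the set of all positive even integers. If $G\in\mathcal{G}(A)$ contains no induced $K_{1,n}$ and no $K_3$, then $\operatorname{def}(G)\le 2n-6$.
   Context: All graphs are finite and simple. The deficiency $\operatorname{def}(G)$ is the number of vertices not saturated by a maximum matching of $G$. For $i\ge 2$, $P_i$ is the path on $i$ vertices and the bone $B_i$ is the tree obtained from $P_i$ by attaching two pendent edges (edges to new degree-one vertices) to each of its two end vertices. For a set $A$ of integers, $\mathcal{G}(A)$ is the family of connected graphs $G$ such that every induced subgraph of $G$ isomorphic to a bone $B_i$ ($i\ge2$) has $i\in A$. -}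

module Defs where

open import Data.Nat using (ℕ; zero; suc; _+_; _*_; _∸_; _≤_; _<_)
open import Data.Nat.Base using (_≡ᵇ_; _<ᵇ_)
open import Data.Bool using (Bool; true; false; _∨_; _∧_; T)
open import Data.Fin using (Fin; toℕ)
open import Data.Product using (Σ; _×_; _,_; ∃)
open import Data.List using (List; []; _∷_; length; concatMap)
open import Data.List.Relation.Unary.All using (All)
open import Data.List.Relation.Unary.Unique.Propositional using (Unique)
open import Relation.Binary.PropositionalEquality using (_≡_; _≢_)
open import Relation.Nullary using (¬_)
open import Function.Definitions using (Injective)

record Graph : Set where
  field
    n     : ℕ
    adj   : Fin n → Fin n → Bool
    sym   : ∀ u v → adj u v ≡ adj v u
    irrefl : ∀ u → adj u u ≡ false
open Graph public

data Reach (G : Graph) : Fin (n G) → Fin (n G) → Set where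
  here : ∀ {u} → Reach G u u
  step : ∀ {u v w} → T (adj G u v) → Reach G v w → Reach G u w

Connected : Graph → Set
Connected G = ∀ u v → Reach G u v

InducedCopy : (G : Graph) (k : ℕ) → (Fin k → Fin k → Bool) → Set
InducedCopy G k H =
  Σ (Fin k → Fin (n G)) λ f →
    Injective _≡_ _≡_ f × (∀ i j → adj G (f i) (f j) ≡ H i j)

-- Bone B_i on i + 4 vertices: path 0 - 1 - ... - (i-1);
-- vertices i, i+1 pendent at 0; vertices i+2, i+3 pendent at i-1.
boneEdgeℕ : ℕ → ℕ → ℕ → Bool
boneEdgeℕ i a b =
  ((suc a ≡ᵇ b) ∧ (b <ᵇ i))
  ∨ ((a ≡ᵇ 0) ∧ ((b ≡ᵇ i) ∨ (b ≡ᵇ suc i)))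
  ∨ ((suc a ≡ᵇ i) ∧ ((b ≡ᵇ i + 2) ∨ (b ≡ᵇ i + 3)))

boneAdjℕ : ℕ → ℕ → ℕ → Bool
boneAdjℕ i a b = boneEdgeℕ i a b ∨ boneEdgeℕ i b a

bone : (i : ℕ) → Fin (i + 4) → Fin (i + 4) → Bool
bone i x y = boneAdjℕ i (toℕ x) (toℕ y)

starAdjℕ : ℕ → ℕ → Bool
starAdjℕ a b = ((a ≡ᵇ 0) ∧ ¬ᵇ (b ≡ᵇ 0)) ∨ ((b ≡ᵇ 0) ∧ ¬ᵇ (a ≡ᵇ 0))
  where
    ¬ᵇ : Bool → Bool
    ¬ᵇ true = false
    ¬ᵇ false = true

star : (t : ℕ) → Fin (suc t) → Fin (suc t) → Bool
star t x y = starAdjℕ (toℕ x) (toℕ y)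

HasClique : Graph → ℕ → Set
HasClique G m =
  Σ (Fin m → Fin (n G)) λ f →
    Injective _≡_ _≡_ f × (∀ i j → i ≢ j → T (adj G (f i) (f j)))

InFamily : (ℕ → Set) → Graph → Set
InFamily A G = Connected G × (∀ i → 2 ≤ i → InducedCopy G (i + 4) (bone i) → A i)

endpoints : ∀ {k} → List (Fin k × Fin k) → List (Fin k)
endpoints = concatMap (λ { (a , b) → a ∷ b ∷ [] })

IsMatching : (G : Graph) → List (Fin (n G) × Fin (n G)) → Set
IsMatching G M = All (λ { (a , b) → T (adj G a b) }) M × Unique (endpoints M)

IsMaximumMatching : (G : Graph) → List (Fin (n G) × Fin (n G)) → Set
IsMaximumMatching G M =
  IsMatching G M × (∀ M' → IsMatching G M' → length M' ≤ length M)

-- def(G) ≤ d : every maximum matching leaves at most d vertices unsaturated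
-- (all maximum matchings leave the same number n - 2ν(G) unsaturated).
DefAtMost : Graph → ℕ → Set
DefAtMost G d = ∀ M → IsMaximumMatching G M → n G ∸ 2 * length M ≤ d

{-# OPTIONS --safe #-}
-- Rank the vertices by distance from a connected set of roots.  While an edge inside the top rank, or
-- a vertex of the rank below together with one of its children, can be deleted without disconnecting
-- the rest, match it and delete it; neither the family nor the ranks of the survivors change.  When
-- this is stuck, the top rank is independent and every vertex below it that has a child has two
-- pendent children, so any two such vertices are the ends of induced bones.
--
-- From an arbitrary root this either ends in a star, of deficiency at most t − 2, or finds a vertex r
-- with two pendent neighbours, which becomes the new root.
--
-- (1) Now a stuck vertex u has rank 2p − 1, since a geodesic from r to u carries a bone.  For distinct
-- such u the vertices of rank p on their geodesics, together with one of rank p − 1, form a clique, so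
-- there are at most m − 2 of them.  Deleting each with its at most t − 2 children costs t − 3, and the
-- star left at r costs t − 2.
--
-- (2) Take the first stuck u, and continue with a geodesic from r to u (of even order, as it carries a
-- bone) and the pendent vertices as roots.  A further stuck vertex would yield three bones whose
-- orders force a triangle, so all remaining vertices are adjacent to the geodesic.  By the same parity
-- argument they are adjacent to r or u, and each of these two stars costs at most t − 3 while the
-- interior of the geodesic is perfectly matched.
module Submission where

open import Defs hiding (sym; step)
open import Data.Nat using (ℕ; zero; suc; _+_; _*_; _∸_; _≤_; _<_; z≤n; s≤s; s≤s⁻¹; _≤?_)
import Data.Nat.Properties as ℕ
open import Data.Nat.Solver using (module +-*-Solver)
open import Data.Nat.Base using (_≡ᵇ_; _<ᵇ_)
open import Data.Bool using (true; false; _∨_; _∧_; T)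
open import Data.Bool.Properties using (T?; T-∨; T-∧)
open import Data.Fin using (Fin; zero; suc; toℕ; inject≤; _≟_)
open import Data.Fin.Properties using (toℕ-injective; toℕ<n; any?; injective⇒≤; inject≤-injective)
open import Data.Product using (Σ; ∃; ∃₂; _×_; _,_; proj₁; proj₂)
open import Data.Sum using (_⊎_; inj₁; inj₂; [_,_]′)
open import Data.Empty using (⊥; ⊥-elim)
open import Data.Unit using (tt)
open import Data.List using (List; []; _∷_; _++_; length; lookup; filter; allFin; applyUpTo)
import Data.List.Properties as List
open import Data.List.Membership.Propositional using (_∈_; _∉_; lose)
import Data.List.Membership.DecPropositional as DecMem
open import Data.List.Membership.Propositional.Properties
  using (∈-filter⁺; ∈-filter⁻; ∈-++⁺ˡ; ∈-++⁺ʳ; ∈-lookup; ∈-allFin; ∈-applyUpTo⁺; ∈-applyUpTo⁻)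
open import Data.List.Relation.Binary.Subset.Propositional using (_⊆_)
open import Data.List.Relation.Unary.All as All using (All; []; _∷_)
open import Data.List.Relation.Unary.Any using (here; there; index)
open import Data.List.Relation.Unary.Any.Properties using (lookup-index)
open import Data.List.Relation.Unary.AllPairs using ([]; _∷_)
open import Data.List.Relation.Unary.Unique.Propositional using (Unique)
import Data.List.Relation.Unary.Unique.Propositional.Properties as Unique
open import Function using (_∘_; case_of_)
open import Function.Bundles using (Equivalence)
open import Function.Definitions using (Injective)
open import Relation.Binary.PropositionalEquality
  using (_≡_; _≢_; refl; sym; trans; cong; subst; subst₂; ≢-sym)
open import Relation.Nullary using (¬_; Dec; yes; no; contradiction)
open import Relation.Nullary.Decidable using (_×-dec_; ¬?; decidable-stable)
open import Relation.Binary.Definitions using (tri<; tri≈; tri>)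

-- Duplicate-free lists, least witnesses and Boolean equality.

lookup-injective : ∀ {A : Set} {xs : List A} → Unique xs → Injective _≡_ _≡_ (lookup xs)
lookup-injective (_ ∷ _) {zero} {zero} _ = refl
lookup-injective (x≢ ∷ _) {zero} {suc j} eq = contradiction eq (All.lookup x≢ (∈-lookup j))
lookup-injective (x≢ ∷ _) {suc i} {zero} eq = contradiction (sym eq) (All.lookup x≢ (∈-lookup i))
lookup-injective (_ ∷ u) {suc i} {suc j} eq = cong suc (lookup-injective u eq)

unique-⊆⇒length≤ : ∀ {A : Set} {xs ys : List A} → Unique xs → xs ⊆ ys → length xs ≤ length ys
unique-⊆⇒length≤ {xs = xs} {ys} u sub = injective⇒≤ {f = f} f-injective
  where
  f : Fin (length xs) → Fin (length ys)
  f i = index (sub (∈-lookup i))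
  f-injective : Injective _≡_ _≡_ f
  f-injective {i} {j} eq = lookup-injective u
    (trans (lookup-index (sub (∈-lookup i)))
      (trans (cong (lookup ys) eq) (sym (lookup-index (sub (∈-lookup j))))))

-- The sum of the values is a crude bound; it only fixes a rank from which `descend` can start.
bounded : ∀ {A : Set} (ρ : A → ℕ) (xs : List A) → ∃ λ K → ∀ {x} → x ∈ xs → ρ x ≤ K
bounded ρ [] = 0 , λ ()
bounded ρ (x ∷ xs) with K , le ← bounded ρ xs = ρ x + K , λ
  { (here refl) → ℕ.m≤m+n _ _
  ; (there y∈) → ℕ.≤-trans (le y∈) (ℕ.m≤n+m _ _) }

record Least (P : ℕ → Set) : Set where
  constructor mkLeast
  field
    value   : ℕ
    holds   : P value
    minimal : ∀ {a} → a < value → ¬ P a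
open Least

least : {P : ℕ → Set} → (∀ a → Dec (P a)) → ∀ {k} → P k → Least P
least {P} P? {k} Pk with P? 0
... | yes P0 = mkLeast 0 P0 λ ()
least {P} P? {zero} Pk | no ¬P0 = contradiction Pk ¬P0
least {P} P? {suc k} Pk | no ¬P0 with least {P ∘ suc} (P? ∘ suc) {k} Pk
... | mkLeast a Pa min = mkLeast (suc a) Pa λ { {zero} _ → ¬P0 ; {suc b} lt → min (s≤s⁻¹ lt) }

≤-value : ∀ {P : ℕ → Set} (l : Least P) {k} → P k → value l ≤ k
≤-value l Pk = ℕ.≮⇒≥ λ lt → minimal l lt Pk

T-≡ : ∀ {b c} → (T b → T c) → (T c → T b) → b ≡ c
T-≡ {true} {true} _ _ = refl
T-≡ {false} {false} _ _ = refl
T-≡ {true} {false} f _ = ⊥-elim (f tt)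
T-≡ {false} {true} _ g = ⊥-elim (g tt)

-- Adjacency and induced stars.

module GraphTheory (G : Graph) where

  V : Set
  V = Fin (n G)

  open DecMem (_≟_ {n G}) using (_∈?_) public

  infix 4 _~_ _~?_
  _~_ : V → V → Set
  u ~ v = T (adj G u v)

  _~?_ : ∀ u v → Dec (u ~ v)
  u ~? v = T? (adj G u v)

  ~-sym : ∀ {u v} → u ~ v → v ~ u
  ~-sym {u} {v} = subst T (Graph.sym G u v)

  ~-irrefl : ∀ {u v} → u ~ v → u ≢ v
  ~-irrefl {u} e refl = subst T (irrefl G u) e

  Far : V → V → Set
  Far u v = u ≢ v × ¬ u ~ v

  Far-sym : ∀ {u v} → Far u v → Far v u
  Far-sym (ne , na) = ≢-sym ne , na ∘ ~-sym

  -- Otherwise the first `t` entries of `C` would be the leaves of an induced star centred at `u`.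
  star-free⇒length< : ∀ {t} → ¬ InducedCopy G (suc t) (star t) → ∀ {u C} → Unique C →
    (∀ {x} → x ∈ C → u ~ x) → (∀ {x y} → x ∈ C → y ∈ C → ¬ x ~ y) → length C < t
  star-free⇒length< {t} free {u} {C} uniq nbr indep = ℕ.≰⇒> λ t≤ → free (copy t≤)
    where
    module _ (t≤ : t ≤ length C) where
      leaf : Fin t → V
      leaf i = lookup C (inject≤ i t≤)
      leaf∈ : ∀ i → leaf i ∈ C
      leaf∈ i = ∈-lookup (inject≤ i t≤)
      f : Fin (suc t) → V
      f zero = u
      f (suc i) = leaf i
      f-injective : Injective _≡_ _≡_ f
      f-injective {zero} {zero} _ = refl
      f-injective {zero} {suc j} eq = contradiction eq (~-irrefl (nbr (leaf∈ j)))
      f-injective {suc i} {zero} eq = contradiction (sym eq) (~-irrefl (nbr (leaf∈ i)))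
      f-injective {suc i} {suc j} eq =
        cong suc (inject≤-injective t≤ t≤ i j (lookup-injective uniq eq))
      f-adj : ∀ i j → adj G (f i) (f j) ≡ star t i j
      f-adj zero zero = irrefl G u
      f-adj zero (suc j) = T-≡ (λ _ → tt) (λ _ → nbr (leaf∈ j))
      f-adj (suc i) zero = T-≡ (λ _ → tt) (λ _ → ~-sym (nbr (leaf∈ i)))
      f-adj (suc i) (suc j) = T-≡ (indep (leaf∈ i) (leaf∈ j)) λ ()
      copy : InducedCopy G (suc t) (star t)
      copy = f , f-injective , f-adj

  -- Induced paths.

  record IndPath (v : ℕ → V) (L : ℕ) : Set where
    field
      step : ∀ {a} → a < L → v a ~ v (suc a)
      far  : ∀ {a b} → suc a < b → b ≤ L → Far (v a) (v b)
  open IndPath public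

  module _ {v L} (P : IndPath v L) where

    path-<⇒≢ : ∀ {a b} → a < b → b ≤ L → v a ≢ v b
    path-<⇒≢ {a} {b} a<b b≤ with ℕ.m≤n⇒m<n∨m≡n a<b
    ... | inj₁ lt = proj₁ (far P lt b≤)
    ... | inj₂ refl = ~-irrefl (step P b≤)

    path-injective : ∀ {a b} → a ≤ L → b ≤ L → v a ≡ v b → a ≡ b
    path-injective {a} {b} a≤ b≤ eq with ℕ.<-cmp a b
    ... | tri< lt _ _ = contradiction eq (path-<⇒≢ lt b≤)
    ... | tri≈ _ e _ = e
    ... | tri> _ _ gt = contradiction (sym eq) (path-<⇒≢ gt a≤)

    path-adjacent : ∀ {a b} → a ≤ L → b ≤ L → v a ~ v b → suc a ≡ b ⊎ suc b ≡ a
    path-adjacent {a} {b} a≤ b≤ e with ℕ.<-cmp a b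
    ... | tri< lt _ _ with ℕ.m≤n⇒m<n∨m≡n lt
    ...   | inj₁ lt′ = contradiction e (proj₂ (far P lt′ b≤))
    ...   | inj₂ eq = inj₁ eq
    path-adjacent {a} {b} a≤ b≤ e | tri≈ _ refl _ = contradiction refl (~-irrefl e)
    path-adjacent {a} {b} a≤ b≤ e | tri> _ _ gt with ℕ.m≤n⇒m<n∨m≡n gt
    ...   | inj₁ gt′ = contradiction (~-sym e) (proj₂ (far P gt′ a≤))
    ...   | inj₂ eq = inj₂ eq

    prefix : ∀ {M} → M ≤ L → IndPath v M
    prefix M≤ = record
      { step = λ lt → step P (ℕ.≤-trans lt M≤)
      ; far = λ lt b≤ → far P lt (ℕ.≤-trans b≤ M≤) }

    reverse : IndPath (λ a → v (L ∸ a)) L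
    reverse = record
      { step = λ {a} lt → ~-sym (subst (λ k → v (L ∸ suc a) ~ v k) (sym (∸-suc lt))
                 (step P (subst (_≤ L) (∸-suc lt) (ℕ.m∸n≤m L a))))
      ; far = λ {a} {b} lt b≤ → Far-sym (far P (gap lt b≤) (ℕ.m∸n≤m L a)) }
      where
      ∸-suc : ∀ {a L} → a < L → L ∸ a ≡ suc (L ∸ suc a)
      ∸-suc {zero} (s≤s _) = refl
      ∸-suc {suc a} (s≤s lt) = ∸-suc lt
      gap : ∀ {a b} → suc a < b → b ≤ L → suc (L ∸ b) < L ∸ a
      gap {a} {b} lt b≤ = subst (suc (L ∸ b) <_) (sym (∸-suc (ℕ.≤-trans (ℕ.n≤1+n _) (ℕ.≤-trans lt b≤))))
        (s≤s (ℕ.∸-monoʳ-< lt b≤))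

  -- Extending and joining induced paths.

  cons : V → (ℕ → V) → ℕ → V
  cons x v zero = x
  cons x v (suc a) = v a

  cons-path : ∀ {x v L} → IndPath v L → x ~ v 0 → (∀ {a} → suc a ≤ L → Far x (v (suc a))) →
    IndPath (cons x v) (suc L)
  cons-path P e f = record
    { step = λ { {zero} _ → e ; {suc a} lt → step P (s≤s⁻¹ lt) }
    ; far = λ { {zero} {suc (suc b)} _ b≤ → f (s≤s⁻¹ b≤)
              ; {suc a} {suc b} lt b≤ → far P (s≤s⁻¹ lt) (s≤s⁻¹ b≤)
              ; {zero} {zero} () ; {zero} {suc zero} (s≤s ()) ; {suc _} {zero} () } }

  -- The walk w e, …, w 0, q 0, q 1, …
  join : (ℕ → V) → (ℕ → V) → ℕ → ℕ → V
  join w q zero = cons (w 0) q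
  join w q (suc e) = cons (w (suc e)) (join w q e)

  join-head : ∀ w q e → join w q e 0 ≡ w e
  join-head w q zero = refl
  join-head w q (suc e) = refl

  join-last : ∀ w q e m → join w q e (suc (e + m)) ≡ q m
  join-last w q zero m = refl
  join-last w q (suc e) m = join-last w q e m

  join-tail : ∀ w q e {m a} → a ≤ e + m →
    (∃ λ k → k < e × join w q e (suc a) ≡ w k) ⊎ (∃ λ j → j ≤ m × join w q e (suc a) ≡ q j)
  join-tail w q zero {a = a} a≤ = inj₂ (a , a≤ , refl)
  join-tail w q (suc e) {a = zero} a≤ = inj₁ (e , ℕ.≤-refl , join-head w q e)
  join-tail w q (suc e) {a = suc a} a≤ with join-tail w q e {a = a} (s≤s⁻¹ a≤)
  ... | inj₁ (k , k< , eq) = inj₁ (k , ℕ.m<n⇒m<1+n k< , eq)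
  ... | inj₂ r = inj₂ r

  join-elem : ∀ w q e {m a} → a ≤ suc (e + m) →
    (∃ λ k → k ≤ e × join w q e a ≡ w k) ⊎ (∃ λ j → j ≤ m × join w q e a ≡ q j)
  join-elem w q e {a = zero} a≤ = inj₁ (e , ℕ.≤-refl , join-head w q e)
  join-elem w q e {a = suc a} a≤ with join-tail w q e (s≤s⁻¹ a≤)
  ... | inj₁ (k , k< , eq) = inj₁ (k , ℕ.<⇒≤ k< , eq)
  ... | inj₂ r = inj₂ r

  -- The edge `w 0 ~ q 0` is the only contact between the two paths, so the joined path has no
  -- chord.
  join-path : ∀ {w q e m} → IndPath w e → IndPath q m → w 0 ~ q 0 →
    (∀ {j} → suc j ≤ m → Far (w 0) (q (suc j))) →
    (∀ {k j} → suc k ≤ e → j ≤ m → Far (w (suc k)) (q j)) →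
    IndPath (join w q e) (suc (e + m))
  join-path {e = zero} W Q e₀ f₀ f = cons-path Q e₀ f₀
  join-path {w} {q} {suc e} {m} W Q e₀ f₀ f =
    cons-path (join-path (prefix W (ℕ.n≤1+n e)) Q e₀ f₀ (λ k≤ → f (ℕ.m≤n⇒m≤1+n k≤)))
      (subst (w (suc e) ~_) (sym (join-head w q e)) (~-sym (step W ℕ.≤-refl)))
      λ a≤ → tail (join-tail w q e (s≤s⁻¹ a≤))
    where
    tail : ∀ {x} → (∃ λ k → k < e × x ≡ w k) ⊎ (∃ λ j → j ≤ m × x ≡ q j) → Far (w (suc e)) x
    tail (inj₁ (k , k< , refl)) = Far-sym (far W (s≤s k<) ℕ.≤-refl)
    tail (inj₂ (j , j≤ , refl)) = f ℕ.≤-refl j≤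

  -- Bones from an induced path with two pendent vertices at each end.

  record End (v : ℕ → V) (L e : ℕ) (x y : V) : Set where
    field
      x≢y : x ≢ y
      x≁y : ¬ x ~ y
      e~x : v e ~ x
      e~y : v e ~ y
      x∉  : ∀ {a} → a ≤ L → x ≢ v a
      y∉  : ∀ {a} → a ≤ L → y ≢ v a
      x-only : ∀ {a} → a ≤ L → x ~ v a → a ≡ e
      y-only : ∀ {a} → a ≤ L → y ~ v a → a ≡ e

  module _ {v L x y z w} (P : IndPath v (suc L))
    (E₁ : End v (suc L) 0 x y) (E₂ : End v (suc L) (suc L) z w)
    (x≁z : ¬ x ~ z) (x≁w : ¬ x ~ w) (y≁z : ¬ y ~ z) (y≁w : ¬ y ~ w) where

    private
      i : ℕ
      i = suc (suc L)
      module E₁ = End E₁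
      module E₂ = End E₂

      pendent : ℕ → V
      pendent 0 = x
      pendent 1 = y
      pendent 2 = z
      -- Only `c < 4` occurs, so this default is the case `c = 3`.
      pendent _ = w

      -- The graph of the embedding of the bone, in the numbering of `bone`: positions below `i` lie
      -- on the path, and `i + c` carries the pendent vertex number `c`.
      data Pos : ℕ → V → Set where
        on    : ∀ {a} → a ≤ suc L → Pos a (v a)
        off   : ∀ c → c < 4 → Pos (i + c) (pendent c)

      pos : ∀ {a} → a < i + 4 → ∃ (Pos a)
      pos {a} a< with a ≤? suc L
      ... | yes a≤ = v a , on a≤
      ... | no a≰ = subst (∃ ∘ Pos) (ℕ.m+[n∸m]≡n i≤a)
              (pendent (a ∸ i) , off (a ∸ i) (ℕ.+-cancelˡ-< i _ _ (subst (_< i + 4) (sym (ℕ.m+[n∸m]≡n i≤a)) a<)))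
        where
        i≤a : i ≤ a
        i≤a = ℕ.≰⇒> a≰

      -- `s` sees `v 0`, while `t` sees the path in `v (suc L)` only.
      across : ∀ {s t} → v 0 ~ s → (∀ {a} → a ≤ suc L → t ~ v a → a ≡ suc L) → s ≢ t
      across e only refl = ℕ.0≢1+n (only z≤n (~-sym e))

      pendent-indep : ∀ c d → c < 4 → d < 4 → ¬ pendent c ~ pendent d
      pendent-indep 0 0 _ _ e = ~-irrefl e refl
      pendent-indep 0 1 _ _ = E₁.x≁y
      pendent-indep 0 2 _ _ = x≁z
      pendent-indep 0 3 _ _ = x≁w
      pendent-indep 1 0 _ _ = E₁.x≁y ∘ ~-sym
      pendent-indep 1 1 _ _ e = ~-irrefl e refl
      pendent-indep 1 2 _ _ = y≁z
      pendent-indep 1 3 _ _ = y≁w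
      pendent-indep 2 0 _ _ = x≁z ∘ ~-sym
      pendent-indep 2 1 _ _ = y≁z ∘ ~-sym
      pendent-indep 2 2 _ _ e = ~-irrefl e refl
      pendent-indep 2 3 _ _ = E₂.x≁y
      pendent-indep 3 0 _ _ = x≁w ∘ ~-sym
      pendent-indep 3 1 _ _ = y≁w ∘ ~-sym
      pendent-indep 3 2 _ _ = E₂.x≁y ∘ ~-sym
      pendent-indep 3 3 _ _ e = ~-irrefl e refl
      pendent-indep (suc (suc (suc (suc _)))) _ (s≤s (s≤s (s≤s (s≤s ())))) _
      pendent-indep 0 (suc (suc (suc (suc _)))) _ (s≤s (s≤s (s≤s (s≤s ()))))
      pendent-indep 1 (suc (suc (suc (suc _)))) _ (s≤s (s≤s (s≤s (s≤s ()))))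
      pendent-indep 2 (suc (suc (suc (suc _)))) _ (s≤s (s≤s (s≤s (s≤s ()))))
      pendent-indep 3 (suc (suc (suc (suc _)))) _ (s≤s (s≤s (s≤s (s≤s ()))))

      pendent-injective : ∀ c d → c < 4 → d < 4 → pendent c ≡ pendent d → c ≡ d
      pendent-injective 0 0 _ _ _ = refl
      pendent-injective 0 1 _ _ eq = contradiction eq E₁.x≢y
      pendent-injective 0 2 _ _ eq = contradiction eq (across E₁.e~x E₂.x-only)
      pendent-injective 0 3 _ _ eq = contradiction eq (across E₁.e~x E₂.y-only)
      pendent-injective 1 0 _ _ eq = contradiction (sym eq) E₁.x≢y
      pendent-injective 1 1 _ _ _ = refl
      pendent-injective 1 2 _ _ eq = contradiction eq (across E₁.e~y E₂.x-only)
      pendent-injective 1 3 _ _ eq = contradiction eq (across E₁.e~y E₂.y-only)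
      pendent-injective 2 0 _ _ eq = contradiction (sym eq) (across E₁.e~x E₂.x-only)
      pendent-injective 2 1 _ _ eq = contradiction (sym eq) (across E₁.e~y E₂.x-only)
      pendent-injective 2 2 _ _ _ = refl
      pendent-injective 2 3 _ _ eq = contradiction eq E₂.x≢y
      pendent-injective 3 0 _ _ eq = contradiction (sym eq) (across E₁.e~x E₂.y-only)
      pendent-injective 3 1 _ _ eq = contradiction (sym eq) (across E₁.e~y E₂.y-only)
      pendent-injective 3 2 _ _ eq = contradiction (sym eq) E₂.x≢y
      pendent-injective 3 3 _ _ _ = refl
      pendent-injective (suc (suc (suc (suc _)))) _ (s≤s (s≤s (s≤s (s≤s ())))) _
      pendent-injective 0 (suc (suc (suc (suc _)))) _ (s≤s (s≤s (s≤s (s≤s ()))))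
      pendent-injective 1 (suc (suc (suc (suc _)))) _ (s≤s (s≤s (s≤s (s≤s ()))))
      pendent-injective 2 (suc (suc (suc (suc _)))) _ (s≤s (s≤s (s≤s (s≤s ()))))
      pendent-injective 3 (suc (suc (suc (suc _)))) _ (s≤s (s≤s (s≤s (s≤s ()))))

      pendent∉ : ∀ c {a} → c < 4 → a ≤ suc L → pendent c ≢ v a
      pendent∉ 0 _ = E₁.x∉
      pendent∉ 1 _ = E₁.y∉
      pendent∉ 2 _ = E₂.x∉
      pendent∉ 3 _ = E₂.y∉
      pendent∉ (suc (suc (suc (suc _)))) (s≤s (s≤s (s≤s (s≤s ()))))

      -- `boneEdgeℕ i` as an inductive relation, so that the comparison with `G` becomes a case
      -- analysis; each edge occurs in one orientation.
      data BoneEdge : ℕ → ℕ → Set where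
        path  : ∀ {a} → a < suc L → BoneEdge a (suc a)
        first : ∀ {c} → c < 2 → BoneEdge 0 (i + c)
        last  : ∀ {c} → 2 ≤ c → c < 4 → BoneEdge (suc L) (i + c)

      pendent~ : ∀ c {a} → c < 4 → a ≤ suc L → pendent c ~ v a → BoneEdge a (i + c)
      pendent~ 0 _ a≤ e with refl ← E₁.x-only a≤ e = first (s≤s z≤n)
      pendent~ 1 _ a≤ e with refl ← E₁.y-only a≤ e = first (s≤s (s≤s z≤n))
      pendent~ 2 c< a≤ e with refl ← E₂.x-only a≤ e = last (s≤s (s≤s z≤n)) c<
      pendent~ 3 c< a≤ e with refl ← E₂.y-only a≤ e = last (s≤s (s≤s z≤n)) c<
      pendent~ (suc (suc (suc (suc _)))) (s≤s (s≤s (s≤s (s≤s ()))))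

      ~⇒BoneEdge : ∀ {a b s t} → Pos a s → Pos b t → s ~ t → BoneEdge a b ⊎ BoneEdge b a
      ~⇒BoneEdge (on a≤) (on b≤) e with path-adjacent P a≤ b≤ e
      ... | inj₁ refl = inj₁ (path b≤)
      ... | inj₂ refl = inj₂ (path a≤)
      ~⇒BoneEdge (on a≤) (off c c<) e = inj₁ (pendent~ c c< a≤ (~-sym e))
      ~⇒BoneEdge (off c c<) (on b≤) e = inj₂ (pendent~ c c< b≤ e)
      ~⇒BoneEdge (off c c<) (off d d<) e = contradiction e (pendent-indep c d c< d<)

      Pos-unique : ∀ {a s t} → Pos a s → Pos a t → s ≡ t
      Pos-unique p q = go p q refl
        where
        go : ∀ {a b s t} → Pos a s → Pos b t → a ≡ b → s ≡ t
        go (on _) (on _) refl = refl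
        go (on a≤) (off c _) refl = contradiction a≤ (ℕ.m+n≮m i c ∘ s≤s)
        go (off c _) (on b≤) refl = contradiction b≤ (ℕ.m+n≮m i c ∘ s≤s)
        go (off c _) (off d _) eq = cong pendent (ℕ.+-cancelˡ-≡ i c d eq)

      BoneEdge⇒~ : ∀ {a b s t} → Pos a s → Pos b t → BoneEdge a b → s ~ t
      BoneEdge⇒~ p q (path a<)
        rewrite Pos-unique p (on (ℕ.<⇒≤ a<)) | Pos-unique q (on a<) = step P a<
      BoneEdge⇒~ p q (first {0} c<)
        rewrite Pos-unique p (on z≤n) | Pos-unique q (off 0 (s≤s z≤n)) = E₁.e~x
      BoneEdge⇒~ p q (first {1} c<)
        rewrite Pos-unique p (on z≤n) | Pos-unique q (off 1 (s≤s (s≤s z≤n))) = E₁.e~y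
      BoneEdge⇒~ p q (first {suc (suc _)} (s≤s (s≤s ())))
      BoneEdge⇒~ p q (last {0} () _)
      BoneEdge⇒~ p q (last {1} (s≤s ()) _)
      BoneEdge⇒~ p q (last {2} _ c<)
        rewrite Pos-unique p (on ℕ.≤-refl) | Pos-unique q (off 2 c<) = E₂.e~x
      BoneEdge⇒~ p q (last {3} _ c<)
        rewrite Pos-unique p (on ℕ.≤-refl) | Pos-unique q (off 3 c<) = E₂.e~y
      BoneEdge⇒~ p q (last {suc (suc (suc (suc _)))} _ (s≤s (s≤s (s≤s (s≤s ())))))

      open Equivalence using (to; from)

      BoneEdge⇒boneEdgeℕ : ∀ {a b} → BoneEdge a b → T (boneEdgeℕ i a b)
      BoneEdge⇒boneEdgeℕ {a} (path a<) = from T-∨ (inj₁ (from T-∧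
        (ℕ.≡⇒≡ᵇ a a refl , ℕ.<⇒<ᵇ (s≤s a<))))
      BoneEdge⇒boneEdgeℕ (first {0} c<) = from (T-∨ {(1 ≡ᵇ i + 0) ∧ (i + 0 <ᵇ i)}) (inj₂ (from T-∨ (inj₁
        (from T-∨ (inj₁ (ℕ.≡⇒≡ᵇ (i + 0) i (ℕ.+-identityʳ i)))))))
      BoneEdge⇒boneEdgeℕ (first {1} c<) = from (T-∨ {(1 ≡ᵇ i + 1) ∧ (i + 1 <ᵇ i)}) (inj₂ (from T-∨ (inj₁
        (from (T-∨ {i + 1 ≡ᵇ i}) (inj₂ (ℕ.≡⇒≡ᵇ (i + 1) (suc i) (ℕ.+-comm i 1)))))))
      BoneEdge⇒boneEdgeℕ (first {suc (suc _)} (s≤s (s≤s ())))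
      BoneEdge⇒boneEdgeℕ (last {0} () _)
      BoneEdge⇒boneEdgeℕ (last {1} (s≤s ()) _)
      BoneEdge⇒boneEdgeℕ (last {2} _ _) = from (T-∨ {(i ≡ᵇ i + 2) ∧ (i + 2 <ᵇ i)}) (inj₂
        (from T-∧ (ℕ.≡⇒≡ᵇ i i refl , from T-∨ (inj₁ (ℕ.≡⇒≡ᵇ (i + 2) (i + 2) refl)))))
      BoneEdge⇒boneEdgeℕ (last {3} _ _) = from (T-∨ {(i ≡ᵇ i + 3) ∧ (i + 3 <ᵇ i)}) (inj₂
        (from T-∧ (ℕ.≡⇒≡ᵇ i i refl , from (T-∨ {i + 3 ≡ᵇ i + 2}) (inj₂ (ℕ.≡⇒≡ᵇ (i + 3) (i + 3) refl)))))
      BoneEdge⇒boneEdgeℕ (last {suc (suc (suc (suc _)))} _ (s≤s (s≤s (s≤s (s≤s ())))))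

      boneEdgeℕ⇒BoneEdge : ∀ a b → T (boneEdgeℕ i a b) → BoneEdge a b
      boneEdgeℕ⇒BoneEdge a b h with to (T-∨ {(suc a ≡ᵇ b) ∧ (b <ᵇ i)}) h
      ... | inj₁ h₁ with q , r ← to (T-∧ {suc a ≡ᵇ b}) h₁ with refl ← ℕ.≡ᵇ⇒≡ (suc a) b q =
        path (s≤s⁻¹ (ℕ.<ᵇ⇒< b i r))
      ... | inj₂ h₂ with to (T-∨ {(a ≡ᵇ 0) ∧ ((b ≡ᵇ i) ∨ (b ≡ᵇ suc i))}) h₂
      ...   | inj₁ h₃ with q , r ← to (T-∧ {a ≡ᵇ 0}) h₃
                with refl ← ℕ.≡ᵇ⇒≡ a 0 q with to (T-∨ {b ≡ᵇ i}) r
      ...     | inj₁ s = subst (BoneEdge 0) (trans (ℕ.+-identityʳ i) (sym (ℕ.≡ᵇ⇒≡ b i s))) (first {0} (s≤s z≤n))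
      ...     | inj₂ s = subst (BoneEdge 0) (trans (ℕ.+-comm i 1) (sym (ℕ.≡ᵇ⇒≡ b (suc i) s))) (first {1} (s≤s (s≤s z≤n)))
      boneEdgeℕ⇒BoneEdge a b h | inj₂ h₂ | inj₂ h₃ with q , r ← to (T-∧ {suc a ≡ᵇ i}) h₃
                with refl ← ℕ.≡ᵇ⇒≡ (suc a) i q with to (T-∨ {b ≡ᵇ i + 2}) r
      ...     | inj₁ s = subst (BoneEdge (suc L)) (sym (ℕ.≡ᵇ⇒≡ b (i + 2) s)) (last (s≤s (s≤s z≤n)) (s≤s (s≤s (s≤s z≤n))))
      ...     | inj₂ s = subst (BoneEdge (suc L)) (sym (ℕ.≡ᵇ⇒≡ b (i + 3) s)) (last (s≤s (s≤s z≤n)) ℕ.≤-refl)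

      Pos-injective : ∀ {a b s t} → Pos a s → Pos b t → s ≡ t → a ≡ b
      Pos-injective (on a≤) (on b≤) eq = path-injective P a≤ b≤ eq
      Pos-injective (on a≤) (off c c<) eq = contradiction (sym eq) (pendent∉ c c< a≤)
      Pos-injective (off c c<) (on b≤) eq = contradiction eq (pendent∉ c c< b≤)
      Pos-injective (off c c<) (off d d<) eq = cong (i +_) (pendent-injective c d c< d< eq)

      f : Fin (i + 4) → V
      f k = proj₁ (pos (toℕ<n k))
      f-pos : ∀ k → Pos (toℕ k) (f k)
      f-pos k = proj₂ (pos (toℕ<n k))

    bone-copy : InducedCopy G (i + 4) (bone i)
    bone-copy = f , (λ {k} {l} eq → toℕ-injective (Pos-injective (f-pos k) (f-pos l) eq)) , λ k l → T-≡
      (λ e → from T-∨ ([ inj₁ ∘ BoneEdge⇒boneEdgeℕ , inj₂ ∘ BoneEdge⇒boneEdgeℕ ]′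
        (~⇒BoneEdge (f-pos k) (f-pos l) e)))
      (λ h → [ BoneEdge⇒~ (f-pos k) (f-pos l) ∘ boneEdgeℕ⇒BoneEdge (toℕ k) (toℕ l)
             , ~-sym ∘ BoneEdge⇒~ (f-pos l) (f-pos k) ∘ boneEdgeℕ⇒BoneEdge (toℕ l) (toℕ k) ]′
        (to (T-∨ {boneEdgeℕ i (toℕ k) (toℕ l)}) h))

-- Leaves, forks and matchings built by deletion.

module Reduction (G : Graph) where
  open GraphTheory G public

  -- For `s` in `H`, a leaf `x` of the subgraph induced by `H`; neighbours of `x` outside `H` are
  -- unrestricted.
  record Pendent (H : List V) (s x : V) : Set where
    field
      mem  : x ∈ H
      link : s ~ x
      only : ∀ {z} → z ∈ H → z ~ x → z ≡ s

  record Fork (H : List V) (s x y : V) : Set where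
    field
      distinct : x ≢ y
      left     : Pendent H s x
      right    : Pendent H s y

  Fork-⊆ : ∀ {H H′ s x y} → H′ ⊆ H → x ∈ H′ → y ∈ H′ → Fork H s x y → Fork H′ s x y
  Fork-⊆ sub x∈ y∈ F = record
    { distinct = Fork.distinct F
    ; left = shrink x∈ (Fork.left F)
    ; right = shrink y∈ (Fork.right F) }
    where
    shrink : ∀ {s x} → x ∈ _ → Pendent _ s x → Pendent _ s x
    shrink x∈ p = record { mem = x∈ ; link = Pendent.link p ; only = Pendent.only p ∘ sub }

  -- If `s` were pendent at `z`, both leaves, being neighbours of `s`, would equal `z`.
  Fork-centre : ∀ {H s x y z} → Fork H s x y → ¬ Pendent H z s
  Fork-centre F p = Fork.distinct F (trans (eq (Fork.left F)) (sym (eq (Fork.right F))))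
    where
    eq : ∀ {x} → Pendent _ _ x → x ≡ _
    eq q = Pendent.only p (Pendent.mem q) (~-sym (Pendent.link q))

  -- An edge `x ~ z` would force `x` to be the centre `t` of a fork, which is not pendent.
  Pendent-indep : ∀ {H s t x z z₁ z₂} → Fork H t z₁ z₂ → Pendent H s x → Pendent H t z → ¬ x ~ z
  Pendent-indep F p q e with refl ← Pendent.only q (Pendent.mem p) e = Fork-centre F p

  End-restrict : ∀ {v L M x y} → M ≤ L → End v L 0 x y → End v M 0 x y
  End-restrict M≤ E = record
    { x≢y = x≢y ; x≁y = x≁y ; e~x = e~x ; e~y = e~y
    ; x∉ = λ a≤ → x∉ (ℕ.≤-trans a≤ M≤)
    ; y∉ = λ a≤ → y∉ (ℕ.≤-trans a≤ M≤)
    ; x-only = λ a≤ → x-only (ℕ.≤-trans a≤ M≤)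
    ; y-only = λ a≤ → y-only (ℕ.≤-trans a≤ M≤) }
    where open End E

  End-reverse : ∀ {v L x y} → End (λ a → v (L ∸ a)) L 0 x y → End v L L x y
  End-reverse {v} {L} E = record
    { x≢y = x≢y ; x≁y = x≁y ; e~x = e~x ; e~y = e~y
    ; x∉ = λ {a} a≤ eq → x∉ (ℕ.m∸n≤m L a) (trans eq (cong v (sym (ℕ.m∸[m∸n]≡n a≤))))
    ; y∉ = λ {a} a≤ eq → y∉ (ℕ.m∸n≤m L a) (trans eq (cong v (sym (ℕ.m∸[m∸n]≡n a≤))))
    ; x-only = only′ x-only ; y-only = only′ y-only }
    where
    open End E
    only′ : ∀ {x} → (∀ {a} → a ≤ L → x ~ v (L ∸ a) → a ≡ 0) → ∀ {a} → a ≤ L → x ~ v a → a ≡ L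
    only′ {x} only {a} a≤ e = ℕ.≤-antisym a≤ (ℕ.m∸n≡0⇒m≤n
      (only (ℕ.m∸n≤m L a) (subst (λ k → x ~ v k) (sym (ℕ.m∸[m∸n]≡n a≤)) e)))

  fork-End : ∀ {H v L x y z w} → IndPath v (suc L) → (∀ {a} → a ≤ suc L → v a ∈ H) →
    Fork H (v 0) x y → Fork H (v (suc L)) z w → End v (suc L) 0 x y
  fork-End {H} {v} {L} {x} {y} P v∈ F F′ = record
    { x≢y = Fork.distinct F
    ; x≁y = Pendent-indep F (Fork.left F) (Fork.right F)
    ; e~x = Pendent.link (Fork.left F)
    ; e~y = Pendent.link (Fork.right F)
    ; x∉ = λ { a≤ refl → off a≤ (Fork.left F) }
    ; y∉ = λ { a≤ refl → off a≤ (Fork.right F) }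
    ; x-only = only (Fork.left F)
    ; y-only = only (Fork.right F) }
    where
    -- On the path only `v 1` is adjacent to `v 0`. It either has the second neighbour `v 2` or is
    -- the last vertex, the centre of `F′`; in both cases it is not pendent.
    off : ∀ {a} → a ≤ suc L → ¬ Pendent H (v 0) (v a)
    off {a} a≤ p with path-adjacent P z≤n a≤ (Pendent.link p)
    ... | inj₁ refl with ℕ.m≤n⇒m<n∨m≡n a≤
    ...   | inj₁ lt = path-<⇒≢ P (s≤s z≤n) lt (sym (Pendent.only p (v∈ lt) (~-sym (step P lt))))
    ...   | inj₂ refl = Fork-centre F′ p
    only : ∀ {x a} → Pendent H (v 0) x → a ≤ suc L → x ~ v a → a ≡ 0
    only p a≤ e = path-injective P a≤ z≤n (Pendent.only p (v∈ a≤) (~-sym e))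

  fork-End-last : ∀ {H v L x y z w} → IndPath v (suc L) → (∀ {a} → a ≤ suc L → v a ∈ H) →
    Fork H (v 0) x y → Fork H (v (suc L)) z w → End v (suc L) (suc L) z w
  fork-End-last {H} {v} {L} {x} {y} P v∈ F F′ = End-reverse
    (fork-End (reverse P) (λ {a} _ → v∈ (ℕ.m∸n≤m (suc L) a)) F′
      (subst (λ k → Fork H (v k) x y) (sym (ℕ.n∸n≡0 L)) F))

  fork-bone : ∀ {H v L x y z w} → IndPath v (suc L) → (∀ {a} → a ≤ suc L → v a ∈ H) →
    Fork H (v 0) x y → Fork H (v (suc L)) z w →
    InducedCopy G (suc (suc L) + 4) (bone (suc (suc L)))
  fork-bone P v∈ F F′ = bone-copy P (fork-End P v∈ F F′) (fork-End-last P v∈ F F′)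
    (Pendent-indep F′ (Fork.left F) (Fork.left F′)) (Pendent-indep F′ (Fork.left F) (Fork.right F′))
    (Pendent-indep F′ (Fork.right F) (Fork.left F′)) (Pendent-indep F′ (Fork.right F) (Fork.right F′))

  -- For duplicate-free `H` this says that the subgraph induced by `H` has deficiency at most `c`.
  Fits : List V → ℕ → Set
  Fits H c = ∃ λ M → IsMatching G M × endpoints M ⊆ H × length H ≤ 2 * length M + c

  fits-empty : ∀ {H c} → length H ≤ c → Fits H c
  fits-empty le = [] , ([] , []) , (λ ()) , le

  -- Adding the edge from `u` to `v` to a matching inside `H′` saturates two of the at most `2 + k`
  -- deleted vertices; the others are charged to the bound.
  fits-edge : ∀ {H H′ C u v k c} → Unique H → H′ ⊆ H → u ∈ H → v ∈ H → u ∉ H′ → v ∉ H′ → u ~ v →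
    H ⊆ C ++ H′ → length C ≤ 2 + k → Fits H′ c → Fits H (k + c)
  fits-edge {H} {H′} {C} {u} {v} {k} {c} uniq sub u∈ v∈ u∉ v∉ e cover C≤ (M , (adjM , uM) , M⊆ , le) =
    (u , v) ∷ M
    , (e ∷ adjM , (~-irrefl e ∷ All.tabulate (λ x∈ eq → u∉ (subst (_∈ H′) (sym eq) (M⊆ x∈))))
                ∷ All.tabulate (λ x∈ eq → v∉ (subst (_∈ H′) (sym eq) (M⊆ x∈)))
                ∷ uM)
    , (λ { (here refl) → u∈ ; (there (here refl)) → v∈ ; (there (there x∈)) → sub (M⊆ x∈) })
    , (begin
        length H ≤⟨ unique-⊆⇒length≤ uniq cover ⟩
        length (C ++ H′) ≡⟨ List.length-++ C ⟩
        length C + length H′ ≤⟨ ℕ.+-mono-≤ C≤ le ⟩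
        (2 + k) + (2 * length M + c) ≡⟨ solve 3 (λ k m c → (con 2 :+ k) :+ (con 2 :* m :+ c) :=
             con 2 :* (con 1 :+ m) :+ (k :+ c)) refl k (length M) c ⟩
        2 * suc (length M) + (k + c) ∎)
    where
    open ℕ.≤-Reasoning
    open +-*-Solver

  infixl 5 _∖_
  _∖_ : List V → List V → List V
  H ∖ X = filter (λ z → ¬? (z ∈? X)) H

  ∈-∖⁺ : ∀ {H X v} → v ∈ H → v ∉ X → v ∈ H ∖ X
  ∈-∖⁺ {X = X} = ∈-filter⁺ (λ z → ¬? (z ∈? X))

  ∈-∖⁻ : ∀ H X {v} → v ∈ H ∖ X → v ∈ H × v ∉ X
  ∈-∖⁻ H X = ∈-filter⁻ (λ z → ¬? (z ∈? X))

  ⊆-∖ : ∀ H X → H ⊆ X ++ (H ∖ X)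
  ⊆-∖ H X {v} v∈ with v ∈? X
  ... | yes v∈X = ∈-++⁺ˡ v∈X
  ... | no v∉X = ∈-++⁺ʳ X (∈-∖⁺ v∈ v∉X)

  fits-∖ : ∀ {H X u v k c} → Unique H → u ∈ H → v ∈ H → u ∈ X → v ∈ X → u ~ v →
    length X ≤ 2 + k → Fits (H ∖ X) c → Fits H (k + c)
  fits-∖ {H} {X} uniq u∈ v∈ u∈X v∈X e = fits-edge uniq (proj₁ ∘ ∈-∖⁻ H X) u∈ v∈
    (λ u∈′ → proj₂ (∈-∖⁻ H X u∈′) u∈X) (λ v∈′ → proj₂ (∈-∖⁻ H X v∈′) v∈X) e (⊆-∖ H X)

  -- These properties make `ρ` the distance within `H` from its vertices of rank 0. In this form one
  -- `ρ` serves all the sets reached by deletions.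
  record Layered (ρ : V → ℕ) (H : List V) : Set where
    field
      unique    : Unique H
      parent    : ∀ {v k} → v ∈ H → ρ v ≡ suc k → ∃ λ u → u ∈ H × u ~ v × ρ u ≡ k
      lipschitz : ∀ {u v} → u ∈ H → v ∈ H → u ~ v → ρ v ≤ suc (ρ u)

  -- `cost` is quantified over `c` so that reductions compose by adding their costs. Keeping all
  -- vertices of rank 0 is what lets forks at the roots persist.
  record Reduces (ρ : V → ℕ) (H : List V) (k : ℕ) (H′ : List V) : Set where
    field
      sub     : H′ ⊆ H
      keep    : ∀ {v} → v ∈ H → ρ v ≡ 0 → v ∈ H′
      cost    : ∀ {c} → Fits H′ c → Fits H (k + c)
      layered : Layered ρ H′

  -- Reduction from the top rank downwards.

  module _ {ρ : V → ℕ} where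

    reduces-refl : ∀ {H} → Layered ρ H → Reduces ρ H 0 H
    reduces-refl lay = record { sub = λ x → x ; keep = λ v∈ _ → v∈ ; cost = λ f → f ; layered = lay }

    reduces-trans : ∀ {H k H′ l H″} → Reduces ρ H k H′ → Reduces ρ H′ l H″ → Reduces ρ H (k + l) H″
    reduces-trans {H} {k} {H′} {l} R S = record
      { sub = R.sub ∘ S.sub
      ; keep = λ v∈ eq → S.keep (R.keep v∈ eq) eq
      ; cost = λ {c} f → subst (Fits H) (sym (ℕ.+-assoc k l c)) (R.cost (S.cost f))
      ; layered = S.layered }
      where
      module R = Reduces R
      module S = Reduces S

    -- The ranks stay valid because every survivor of positive rank keeps a parent outside `X`; of
    -- the deleted vertices, `u` and `v` are matched.
    reduces-∖ : ∀ {H X u v k} → Layered ρ H → u ∈ H → v ∈ H → u ∈ X → v ∈ X → u ~ v →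
      length X ≤ 2 + k → (∀ {x} → x ∈ X → ρ x ≢ 0) →
      (∀ {z k} → z ∈ H → z ∉ X → ρ z ≡ suc k → ∃ λ p → p ∈ H × p ∉ X × p ~ z × ρ p ≡ k) →
      Reduces ρ H k (H ∖ X)
    reduces-∖ {H} {X} lay u∈ v∈ u∈X v∈X e X≤ pos par = record
      { sub = proj₁ ∘ ∈-∖⁻ H X
      ; keep = λ v∈ eq → ∈-∖⁺ v∈ λ v∈X → pos v∈X eq
      ; cost = fits-∖ unique u∈ v∈ u∈X v∈X e X≤
      ; layered = record
        { unique = Unique.filter⁺ _ unique
        ; parent = λ z∈ eq → let z∈H , z∉ = ∈-∖⁻ H X z∈ ; p , p∈ , p∉ , e , ρp = par z∈H z∉ eq
                             in p , ∈-∖⁺ p∈ p∉ , e , ρp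
        ; lipschitz = λ u∈ v∈ → lipschitz (proj₁ (∈-∖⁻ H X u∈)) (proj₁ (∈-∖⁻ H X v∈)) } }
      where open Layered lay

    -- A parent never has the top rank, so deleting vertices of the top rank leaves no survivor
    -- without a parent.
    below-top : ∀ {j k x} → x ≤ suc j → ∀ {p} → x ≡ suc k → p ≡ k → p ≢ suc j
    below-top le refl refl refl = ℕ.1+n≰n le

    Bounded : List V → ℕ → Set
    Bounded H k = ∀ {v} → v ∈ H → ρ v ≤ k

    IndependentAt : List V → ℕ → Set
    IndependentAt H k = ∀ {x y} → x ∈ H → y ∈ H → ρ x ≡ k → ρ y ≡ k → ¬ x ~ y

    Child : List V → V → V → Set
    Child H u v = v ∈ H × ρ v ≡ suc (ρ u) × u ~ v

    child? : ∀ H u v → Dec (Child H u v)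
    child? H u v = v ∈? H ×-dec (ρ v ℕ.≟ suc (ρ u)) ×-dec u ~? v

    record Star (H : List V) (u : V) : Set where
      field
        {x y} : V
        fork  : Fork H u x y
        ρx    : ρ x ≡ suc (ρ u)
        ρy    : ρ y ≡ suc (ρ u)

    record Stuck (j : ℕ) (H : List V) : Set where
      field
        independent : IndependentAt H (suc j)
        forked      : ∀ {u v} → u ∈ H → ρ u ≡ j → 1 ≤ j → Child H u v → Star H u

    private
      OtherParent : List V → V → V → Set
      OtherParent H u w = ∃ λ p → p ∈ H × ρ p ≡ ρ u × p ≢ u × p ~ w

      otherParent? : ∀ H u w → Dec (OtherParent H u w)
      otherParent? H u w = any? λ p → p ∈? H ×-dec (ρ p ℕ.≟ ρ u) ×-dec ¬? (p ≟ u) ×-dec p ~? w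

      -- A child `w` of `u` that would be left without a parent if `u` and `v` were deleted.
      OtherPrivate : List V → V → V → Set
      OtherPrivate H u v = ∃ λ w → Child H u w × w ≢ v × ¬ OtherParent H u w

      otherPrivate? : ∀ H u v → Dec (OtherPrivate H u v)
      otherPrivate? H u v = any? λ w → child? H u w ×-dec ¬? (w ≟ v) ×-dec ¬? (otherParent? H u w)

      TopEdge : List V → ℕ → Set
      TopEdge H j = ∃₂ λ x y → x ∈ H × y ∈ H × ρ x ≡ suc j × ρ y ≡ suc j × x ~ y

      topEdge? : ∀ H j → Dec (TopEdge H j)
      topEdge? H j = any? λ x → any? λ y →
        x ∈? H ×-dec y ∈? H ×-dec (ρ x ℕ.≟ suc j) ×-dec (ρ y ℕ.≟ suc j) ×-dec x ~? y

      Removable : List V → ℕ → Set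
      Removable H j = ∃₂ λ u v → u ∈ H × ρ u ≡ j × 1 ≤ j × Child H u v × ¬ OtherPrivate H u v

      removable? : ∀ H j → Dec (Removable H j)
      removable? H j = any? λ u → any? λ v →
        u ∈? H ×-dec (ρ u ℕ.≟ j) ×-dec (1 ≤? j) ×-dec child? H u v ×-dec ¬? (otherPrivate? H u v)

    -- `second` is applied twice: the child `v` yields a private child `w`, and `w` yields another
    -- one, `w′`. A private child is a leaf: its neighbours have rank at least `ρ u`, none of that
    -- rank is different from `u`, and none has the top rank, where there are no edges.
    stuck : ∀ {H j} → Layered ρ H → Bounded H (suc j) → ¬ TopEdge H j → ¬ Removable H j → Stuck j H
    stuck {H} {j} lay bnd ¬top ¬rem = record
      { independent = λ x∈ y∈ ρx ρy e → ¬top (_ , _ , x∈ , y∈ , ρx , ρy , e)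
      ; forked = λ { u∈ refl 1≤ ch →
          let w  , chw  , _     , priv  = second u∈ refl 1≤ ch
              w′ , chw′ , w′≢w , priv′ = second u∈ refl 1≤ chw
          in record { fork = record { distinct = ≢-sym w′≢w
                                    ; left = pendent refl chw priv ; right = pendent refl chw′ priv′ }
                    ; ρx = proj₁ (proj₂ chw) ; ρy = proj₁ (proj₂ chw′) } } }
      where
      second : ∀ {u v} → u ∈ H → ρ u ≡ j → 1 ≤ j → Child H u v → OtherPrivate H u v
      second {u} {v} u∈ eq 1≤ ch = decidable-stable (otherPrivate? H u v)
        λ ¬op → ¬rem (u , v , u∈ , eq , 1≤ , ch , ¬op)
      pendent : ∀ {u w} → ρ u ≡ j → Child H u w → ¬ OtherParent H u w → Pendent H u w
      pendent {u} {w} refl (w∈ , ρw , e) priv = record { mem = w∈ ; link = e ; only = only }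
        where
        only : ∀ {z} → z ∈ H → z ~ w → z ≡ u
        only {z} z∈ z~w with ρ z ℕ.≟ ρ u
        ... | yes eq = decidable-stable (z ≟ u) λ z≢u → priv (z , z∈ , eq , z≢u , z~w)
        ... | no ne = contradiction (z , w , z∈ , w∈ , ℕ.≤-antisym (bnd z∈) (ℕ.≤∧≢⇒< (s≤s⁻¹ lip) (≢-sym ne)) , ρw , z~w) ¬top
          where
          lip : suc (ρ u) ≤ suc (ρ z)
          lip = subst (_≤ suc (ρ z)) ρw (Layered.lipschitz lay z∈ w∈ z~w)

    -- Recursion on a bound `s` for the number of vertices; every round deletes the two ends of one
    -- edge, which is matched, so the cost is 0.
    reduce : ∀ s {H j} → length H ≤ s → Layered ρ H → Bounded H (suc j) →
      ∃ λ H′ → Reduces ρ H 0 H′ × Stuck j H′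
    reduce-by : ∀ s {H j u v} → length H ≤ s → Layered ρ H → Bounded H (suc j) → u ∈ H →
      Reduces ρ H 0 (H ∖ (u ∷ v ∷ [])) → ∃ λ H′ → Reduces ρ H 0 H′ × Stuck j H′

    reduce-by zero {[]} le lay bnd () red
    reduce-by (suc s) {H} {j} {u} {v} le lay bnd u∈ red =
      let H′ , red′ , st = reduce s {H ∖ (u ∷ v ∷ [])} (s≤s⁻¹ (ℕ.≤-trans shorter le)) (Reduces.layered red)
                              (bnd ∘ Reduces.sub red)
      in H′ , reduces-trans red red′ , st
      where
      shorter : length (H ∖ (u ∷ v ∷ [])) < length H
      shorter = List.filter-notAll (λ z → ¬? (z ∈? (u ∷ v ∷ []))) H
        (lose u∈ λ u∉ → u∉ (here refl))

    reduce s {H} {j} le lay bnd with topEdge? H j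
    ... | yes (x , y , x∈ , y∈ , ρx , ρy , e) = reduce-by s le lay bnd x∈
          (reduces-∖ lay x∈ y∈ (here refl) (there (here refl)) e ℕ.≤-refl
            (λ { (here refl) eq → ℕ.1+n≢0 (trans (sym ρx) eq)
               ; (there (here refl)) eq → ℕ.1+n≢0 (trans (sym ρy) eq) })
            λ z∈ _ eq → let p , p∈ , p~z , ρp = Layered.parent lay z∈ eq in
              p , p∈ , (λ { (here refl) → below-top (bnd z∈) eq ρp ρx
                          ; (there (here refl)) → below-top (bnd z∈) eq ρp ρy }) , p~z , ρp)
    ... | no ¬top with removable? H j
    ...   | no ¬rem = H , reduces-refl lay , stuck lay bnd ¬top ¬rem
    ...   | yes (u , v , u∈ , refl , 1≤ , (v∈ , ρv , u~v) , ¬op) = reduce-by s le lay bnd u∈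
          (reduces-∖ lay u∈ v∈ (here refl) (there (here refl)) u~v ℕ.≤-refl
            (λ { (here refl) eq → ℕ.<⇒≢ 1≤ (sym eq)
               ; (there (here refl)) eq → ℕ.1+n≢0 (trans (sym ρv) eq) })
            par)
      where
      X : List V
      X = u ∷ v ∷ []
      -- A survivor with parent `u` is a child of `u` other than `v`. As `u` has no other private
      -- child, it has a second parent.
      par : ∀ {z k} → z ∈ H → z ∉ X → ρ z ≡ suc k → ∃ λ p → p ∈ H × p ∉ X × p ~ z × ρ p ≡ k
      par {z} z∈ z∉ eq with Layered.parent lay z∈ eq
      ... | p , p∈ , p~z , refl with p ≟ u
      ...   | no p≢u = p , p∈ , (λ { (here refl) → p≢u refl
                                   ; (there (here refl)) → below-top (bnd z∈) eq refl ρv }) , p~z , refl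
      ...   | yes refl with decidable-stable (otherParent? H u z)
                 (λ ¬opar → ¬op (z , (z∈ , eq , p~z) , (λ { refl → z∉ (there (here refl)) }) , ¬opar))
      ...     | q , q∈ , ρq , q≢u , q~z =
                q , q∈ , (λ { (here refl) → q≢u refl
                            ; (there (here refl)) → below-top (bnd z∈) eq ρq ρv }) , q~z , ρq

    hasRank? : ∀ H k → Dec (∃ λ v → v ∈ H × ρ v ≡ k)
    hasRank? H k = any? λ v → v ∈? H ×-dec (ρ v ℕ.≟ k)

    bounded-pred : ∀ {H k} → Bounded H (suc k) → ¬ (∃ λ v → v ∈ H × ρ v ≡ suc k) → Bounded H k
    bounded-pred bnd none v∈ = s≤s⁻¹ (ℕ.≤∧≢⇒< (bnd v∈) λ eq → none (_ , v∈ , eq))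

    -- After `reduce` the top rank is either empty, and the bound drops by one, or contains a
    -- vertex, whose parent is then the centre of a star. With `1 ≤ lo` that parent is not a root.
    descend : ∀ d {lo H} → 1 ≤ lo → Layered ρ H → Bounded H (d + lo) →
      ∃ λ H′ → Reduces ρ H 0 H′ ×
        (Bounded H′ lo ⊎ ∃ λ u → u ∈ H′ × lo ≤ ρ u × Star H′ u)
    descend zero {H = H} 1≤ lay bnd = H , reduces-refl lay , inj₁ bnd
    descend (suc d) {lo} {H} 1≤ lay bnd with reduce (length H) ℕ.≤-refl lay bnd
    ... | H₁ , red , st with hasRank? H₁ (suc d + lo)
    ...   | no none with descend d 1≤ (Reduces.layered red) (bounded-pred (bnd ∘ Reduces.sub red) none)
    ...     | H₂ , red′ , r = H₂ , reduces-trans red red′ , r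
    descend (suc d) {lo} {H} 1≤ lay bnd | H₁ , red , st | yes (v , v∈ , eq)
      with u , u∈ , u~v , ρu ← Layered.parent (Reduces.layered red) v∈ eq =
      H₁ , red , inj₂ (u , u∈ , subst (lo ≤_) (sym ρu) (ℕ.m≤n+m lo d) ,
        Stuck.forked st u∈ ρu (ℕ.≤-trans 1≤ (ℕ.m≤n+m lo d)) (v∈ , trans eq (cong suc (sym ρu)) , u~v))

-- Distance ranks and geodesics.

module Ranks (G : Graph) where
  open Reduction G public

  Walk : List V → List V → ℕ → V → Set
  Walk H R zero v = v ∈ R
  Walk H R (suc k) v = ∃ λ u → Walk H R k u × u ~ v × v ∈ H

  walk? : ∀ H R k v → Dec (Walk H R k v)
  walk? H R zero v = v ∈? R
  walk? H R (suc k) v = any? λ u → walk? H R k u ×-dec u ~? v ×-dec v ∈? H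

  record Ranking (H R : List V) : Set where
    field
      ρ        : V → ℕ
      layered  : Layered ρ H
      root⇒0   : ∀ {v} → v ∈ R → ρ v ≡ 0
      0⇒root   : ∀ {v} → v ∈ H → ρ v ≡ 0 → v ∈ R

  module _ {H R : List V} (uniq : Unique H) (R⊆H : R ⊆ H) (reach : ∀ {v} → v ∈ H → ∃ λ k → Walk H R k v) where

    private
      walk∈ : ∀ {k v} → Walk H R k v → v ∈ H
      walk∈ {zero} v∈ = R⊆H v∈
      walk∈ {suc k} (_ , _ , _ , v∈) = v∈

      dist : ∀ {v} → v ∈ H → Least (λ k → Walk H R k v)
      dist {v} v∈ = least (λ k → walk? H R k v) (proj₂ (reach v∈))

      ρ : V → ℕ
      ρ v with v ∈? H
      ... | yes v∈ = value (dist v∈)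
      -- A default outside `H`, where `Layered` asserts nothing; with `0`, `ρ-≤` holds there
      -- trivially.
      ... | no _ = 0

      ρ-walk : ∀ {v} → v ∈ H → Walk H R (ρ v) v
      ρ-walk {v} v∈ with v ∈? H
      ... | yes v∈′ = holds (dist v∈′)
      ... | no v∉ = contradiction v∈ v∉

      ρ-≤ : ∀ {v k} → Walk H R k v → ρ v ≤ k
      ρ-≤ {v} w with v ∈? H
      ... | yes v∈ = ≤-value (dist v∈) w
      ... | no _ = z≤n

    -- The last but one vertex of a shortest walk is a parent: by minimality its own distance is
    -- exactly one less.
    ranking : Ranking H R
    ranking = record
      { ρ = ρ
      ; layered = record
        { unique = uniq
        ; parent = λ {v} v∈ eq → parent v∈ eq (subst (λ k → Walk H R k v) eq (ρ-walk v∈))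
        ; lipschitz = λ u∈ v∈ e → ρ-≤ (_ , ρ-walk u∈ , e , v∈) }
      ; root⇒0 = λ v∈ → ℕ.n≤0⇒n≡0 (ρ-≤ v∈)
      ; 0⇒root = λ {v} v∈ eq → subst (λ k → Walk H R k v) eq (ρ-walk v∈) }
      where
      parent : ∀ {v k} → v ∈ H → ρ v ≡ suc k → Walk H R (suc k) v → ∃ λ u → u ∈ H × u ~ v × ρ u ≡ k
      parent v∈ eq (u , w , e , _) = u , walk∈ w , e ,
        ℕ.≤-antisym (ρ-≤ w) (s≤s⁻¹ (subst (_≤ suc (ρ u)) eq (ρ-≤ (u , ρ-walk (walk∈ w) , e , v∈))))

  module _ {ρ H} (lay : Layered ρ H) where
    open Layered lay

    -- For changing the root set: if the new roots reach all old ones, they reach every vertex along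
    -- chains of parents.
    walk-from-roots : ∀ {R} → (∀ {z} → z ∈ H → ρ z ≡ 0 → ∃ λ k → Walk H R k z) →
      ∀ k {v} → v ∈ H → ρ v ≡ k → ∃ λ l → Walk H R l v
    walk-from-roots root zero v∈ eq = root v∈ eq
    walk-from-roots root (suc k) v∈ eq with u , u∈ , e , ρu ← parent v∈ eq
      with l , w ← walk-from-roots root k u∈ ρu = suc l , u , w , e , v∈

    -- The counterpart of `walk-from-roots`: following parents extends a walk from the new roots to
    -- some old root.
    walk-to-root : ∀ {R} k {v l} → v ∈ H → ρ v ≡ k → Walk H R l v →
      ∃₂ λ z l′ → z ∈ H × ρ z ≡ 0 × Walk H R l′ z
    walk-to-root zero v∈ eq w = _ , _ , v∈ , eq , w
    walk-to-root (suc k) v∈ eq w with u , u∈ , e , ρu ← parent v∈ eq =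
      walk-to-root k u∈ ρu (_ , w , ~-sym e , u∈)

    rank-gap : ∀ {x y} → x ∈ H → y ∈ H → suc (ρ x) < ρ y → Far x y
    rank-gap x∈ y∈ lt =
      (λ { refl → ℕ.1+n≰n (ℕ.≤-trans (ℕ.n≤1+n _) lt) }) , λ e → ℕ.<⇒≱ lt (lipschitz x∈ y∈ e)

    -- A chain of parents is an induced path, since the ranks of nonconsecutive vertices differ by
    -- at least two.
    descent : ∀ L {u} → u ∈ H → ρ u ≡ L → ∃ λ z →
      z 0 ≡ u × (∀ {a} → a ≤ L → z a ∈ H × ρ (z a) ≡ L ∸ a) × IndPath z L
    descent zero {u} u∈ eq = (λ _ → u) , refl , (λ { z≤n → u∈ , eq })
      , record { step = λ () ; far = λ { () z≤n } }
    descent (suc L) {u} u∈ eq with p , p∈ , e , ρp ← parent u∈ eq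
      with z , refl , in-z , path ← descent L p∈ ρp = cons u z , refl
      , (λ { z≤n → u∈ , eq ; (s≤s a≤) → in-z a≤ })
      , cons-path path (~-sym e) λ {a} a≤ → Far-sym (rank-gap (proj₁ (in-z a≤)) u∈
          (subst₂ _<_ (cong suc (sym (proj₂ (in-z a≤)))) (sym eq)
            (s≤s (below a≤))))
      where
      below : ∀ {a L} → suc a ≤ L → suc (L ∸ suc a) ≤ L
      below {a} {suc L} _ = s≤s (ℕ.m∸n≤m L a)

  record Geodesic (ρ : V → ℕ) (H : List V) (u : V) (L : ℕ) : Set where
    field
      at     : ℕ → V
      at-end : at L ≡ u
      inside : ∀ {a} → a ≤ L → at a ∈ H
      rank   : ∀ {a} → a ≤ L → ρ (at a) ≡ a
      path   : IndPath at L

  geodesic : ∀ {ρ H u L} → Layered ρ H → u ∈ H → ρ u ≡ L → Geodesic ρ H u L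
  geodesic {ρ} {H} {L = L} lay u∈ eq with z , z0 , in-z , path ← descent lay L u∈ eq = record
    { at = λ a → z (L ∸ a)
    ; at-end = trans (cong z (ℕ.n∸n≡0 L)) z0
    ; inside = λ {a} _ → proj₁ (in-z (ℕ.m∸n≤m L a))
    ; rank = λ {a} a≤ → trans (proj₂ (in-z (ℕ.m∸n≤m L a))) (ℕ.m∸[m∸n]≡n a≤)
    ; path = reverse path }

  fits-mono : ∀ {H c d} → c ≤ d → Fits H c → Fits H d
  fits-mono c≤d (M , mM , M⊆ , le) = M , mM , M⊆ , ℕ.≤-trans le (ℕ.+-monoʳ-≤ (2 * length M) c≤d)

  reduces-mono : ∀ {ρ H k l H′} → k ≤ l → Reduces ρ H k H′ → Reduces ρ H l H′
  reduces-mono k≤l R = record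
    { sub = sub ; keep = keep ; cost = fits-mono (ℕ.+-monoˡ-≤ _ k≤l) ∘ cost ; layered = layered }
    where open Reduces R

  empty-length : ∀ {H : List V} → (∀ {z} → z ∉ H) → length H ≤ 0
  empty-length {[]} none = z≤n
  empty-length {x ∷ H} none = contradiction (here refl) none

  -- Matching costs in the absence of an induced star with `t = 3 + s` leaves.

  module StarFree {s : ℕ} (star-free : ¬ InducedCopy G (suc (3 + s)) (star (3 + s))) where

    -- There are at most `s + 2` leaves, and the edge from `r` to one of them leaves `s + 1`
    -- unsaturated. Without a leaf, only `r` is unsaturated.
    fits-star : ∀ {H r} → Unique H → r ∈ H → (∀ {z} → z ∈ H → z ≢ r → r ~ z) →
      (∀ {x y} → x ∈ H → y ∈ H → x ≢ r → y ≢ r → ¬ x ~ y) → Fits H (suc s)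
    fits-star {H} {r} uniq r∈ nbr indep = go (any? λ a → a ∈? N)
      where
      N : List V
      N = filter (λ z → ¬? (z ≟ r)) H
      N⁻ : ∀ {z} → z ∈ N → z ∈ H × z ≢ r
      N⁻ = ∈-filter⁻ (λ z → ¬? (z ≟ r)) {xs = H}
      H⊆ : H ⊆ r ∷ N
      H⊆ {z} z∈ with z ≟ r
      ... | yes z≡r = here z≡r
      ... | no z≢r = there (∈-filter⁺ (λ z → ¬? (z ≟ r)) z∈ z≢r)
      N< : length N < 3 + s
      N< = star-free⇒length< star-free (Unique.filter⁺ (λ z → ¬? (z ≟ r)) uniq)
        (λ z∈ → nbr (proj₁ (N⁻ z∈)) (proj₂ (N⁻ z∈)))
        (λ x∈ y∈ → indep (proj₁ (N⁻ x∈)) (proj₁ (N⁻ y∈)) (proj₂ (N⁻ x∈)) (proj₂ (N⁻ y∈)))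
      go : Dec (∃ λ a → a ∈ N) → Fits H (suc s)
      go (no none) = fits-empty (ℕ.≤-trans (unique-⊆⇒length≤ uniq H⊆)
        (s≤s (ℕ.≤-trans (empty-length (λ z∈ → none (_ , z∈))) z≤n)))
      go (yes (a , a∈)) = subst (Fits H) (ℕ.+-identityʳ (suc s))
        (fits-∖ {X = r ∷ N} uniq r∈ (proj₁ (N⁻ a∈)) (here refl) (there a∈)
          (nbr (proj₁ (N⁻ a∈)) (proj₂ (N⁻ a∈))) N<
          (fits-empty (empty-length λ z∈ → let z∈H , z∉ = ∈-∖⁻ H (r ∷ N) z∈ in z∉ (H⊆ z∈H))))

    module _ {ρ : V → ℕ} where

      -- `reduce` matches off the edges between vertices of rank 1. These all have parent `r`,
      -- because a pendent root has no neighbour but `r`; so a star centred at `r` remains.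
      fits-bounded : ∀ {H r} → Layered ρ H → Bounded {ρ} H 1 → r ∈ H → ρ r ≡ 0 →
        (∀ {z} → z ∈ H → ρ z ≡ 0 → z ≡ r ⊎ Pendent H r z) → Fits H (suc s)
      fits-bounded {H} {r} lay bnd r∈ ρr roots with H′ , red , st ← reduce (length H) ℕ.≤-refl lay bnd =
        cost (fits-star (Layered.unique layered) (keep r∈ ρr) nbr indep)
        where
        open Reduces red
        data Kind (z : V) : Set where
          pendent : Pendent H r z → Kind z
          level1  : ρ z ≡ 1 → r ~ z → Kind z
        kind : ∀ {z} → z ∈ H → z ≢ r → Kind z
        kind {z} z∈ z≢r with ℕ.m≤n⇒m<n∨m≡n (bnd z∈)
        ... | inj₁ ρ<1 with roots z∈ (ℕ.n<1⇒n≡0 ρ<1)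
        ...   | inj₁ z≡r = contradiction z≡r z≢r
        ...   | inj₂ p = pendent p
        kind {z} z∈ z≢r | inj₂ ρz with u , u∈ , e , ρu ← Layered.parent lay z∈ ρz with roots u∈ ρu
        ... | inj₁ refl = level1 ρz e
        ... | inj₂ p = contradiction (Pendent.only p z∈ (~-sym e)) z≢r
        nbr : ∀ {z} → z ∈ H′ → z ≢ r → r ~ z
        nbr z∈ z≢r with kind (sub z∈) z≢r
        ... | pendent p = Pendent.link p
        ... | level1 _ e = e
        indep : ∀ {x y} → x ∈ H′ → y ∈ H′ → x ≢ r → y ≢ r → ¬ x ~ y
        indep x∈ y∈ x≢r y≢r e with kind (sub x∈) x≢r | kind (sub y∈) y≢r
        ... | pendent p | _ = y≢r (Pendent.only p (sub y∈) (~-sym e))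
        ... | level1 _ _ | pendent p = x≢r (Pendent.only p (sub x∈) e)
        ... | level1 ρx _ | level1 ρy _ = Stuck.independent st x∈ y∈ ρx ρy e

      -- The children `C` of `u` together with a parent `z` of `u` are the leaves of an induced
      -- star, so `C` has at most `s + 1` entries. One child is matched with `u` and at most `s` are
      -- lost; counting `z` saves one compared with `fits-star`.
      peel : ∀ {H j u v} → Layered ρ H → Bounded {ρ} H (suc (suc j)) → IndependentAt {ρ} H (suc (suc j)) →
        u ∈ H → ρ u ≡ suc j → Child {ρ} H u v →
        ∃ λ X → u ∈ X × Reduces ρ H s (H ∖ X)
      peel {H} {j} {u} {v} lay bnd indep u∈ ρu ch@(v∈ , ρv , u~v)
        with z , z∈ , z~u , ρz ← Layered.parent lay u∈ ρu = u ∷ C , here refl ,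
        reduces-∖ lay u∈ v∈ (here refl) (there (∈-filter⁺ (child? H u) v∈ ch)) u~v (s≤s⁻¹ zC<)
          (λ { (here refl) eq → ℕ.1+n≢0 (trans (sym ρu) eq)
             ; (there c∈) eq → ℕ.1+n≢0 (trans (sym (ρC c∈)) eq) })
          λ {w} w∈ w∉ eq → let p , p∈ , p~w , ρp = Layered.parent lay w∈ eq in p , p∈
            , (λ { (here refl) → w∉ (there (∈-filter⁺ (child? H u) w∈
                     (w∈ , trans eq (cong suc (sym ρp)) , p~w)))
                 ; (there p∈C) → below-top {ρ} (bnd w∈) eq ρp (ρC p∈C) })
            , p~w , ρp
        where
        C : List V
        C = filter (child? H u) H
        C⁻ : ∀ {c} → c ∈ C → c ∈ H × Child {ρ} H u c
        C⁻ = ∈-filter⁻ (child? H u) {xs = H}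
        ρC : ∀ {c} → c ∈ C → ρ c ≡ suc (suc j)
        ρC c∈ = trans (proj₁ (proj₂ (proj₂ (C⁻ c∈)))) (cong suc ρu)
        z≁C : ∀ {c} → c ∈ C → Far z c
        z≁C c∈ = rank-gap lay z∈ (proj₁ (C⁻ c∈))
          (ℕ.≤-reflexive (trans (cong (λ k → suc (suc k)) ρz) (sym (ρC c∈))))
        zC< : length (z ∷ C) < 3 + s
        zC< = star-free⇒length< star-free {u}
          (All.tabulate (λ c∈ → proj₁ (z≁C c∈)) ∷ Unique.filter⁺ (child? H u) (Layered.unique lay))
          (λ { (here refl) → ~-sym z~u ; (there c∈) → proj₂ (proj₂ (proj₂ (C⁻ c∈))) })
          λ { (here refl) (here refl) e → ~-irrefl e refl
            ; (here refl) (there c∈) → proj₂ (z≁C c∈)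
            ; (there c∈) (here refl) → proj₂ (z≁C c∈) ∘ ~-sym
            ; (there c∈) (there d∈) → indep (proj₁ (C⁻ c∈)) (proj₁ (C⁻ d∈)) (ρC c∈) (ρC d∈) }

      -- Once no vertex of rank `suc j` has a child, the top rank is empty, as its vertices would
      -- need parents. An entry already deleted or without children is still charged `s`, so that
      -- the total depends on the length of `us` only.
      peel-all : ∀ us {H j} → Layered ρ H → Bounded {ρ} H (suc (suc j)) → IndependentAt {ρ} H (suc (suc j)) →
        (∀ {u v} → u ∈ H → ρ u ≡ suc j → Child {ρ} H u v → u ∈ us) →
        ∃ λ H′ → Reduces ρ H (length us * s) H′ × Bounded {ρ} H′ (suc j)
      peel-all [] {H} lay bnd indep all = H , reduces-refl lay , bounded-pred {ρ} bnd
        λ { (v , v∈ , ρv) → let u , u∈ , e , ρu = Layered.parent lay v∈ ρv in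
              case all u∈ ρu (v∈ , trans ρv (cong suc (sym ρu)) , e) of (λ ()) }
      peel-all (u ∷ us) {H} {j} lay bnd indep all
        with u ∈? H ×-dec (ρ u ℕ.≟ suc j) ×-dec any? (child? {ρ} H u)
      ... | yes (u∈ , ρu , v , ch) with X , u∈X , red ← peel lay bnd indep u∈ ρu ch
        with H′ , red′ , bnd′ ← peel-all us {H ∖ X} (Reduces.layered red) (bnd ∘ Reduces.sub red)
               (λ x∈ y∈ → indep (Reduces.sub red x∈) (Reduces.sub red y∈))
               (λ { w∈ ρw (v∈ , r) → case all (Reduces.sub red w∈) ρw (Reduces.sub red v∈ , r) of λ
                     { (here refl) → contradiction u∈X (proj₂ (∈-∖⁻ H X w∈))
                     ; (there w∈us) → w∈us } }) = H′ , reduces-trans red red′ , bnd′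
      peel-all (u ∷ us) {H} {j} lay bnd indep all | no ¬u
        with H′ , red′ , bnd′ ← peel-all us {H} lay bnd indep
               (λ { w∈ ρw ch → case all w∈ ρw ch of λ
                     { (here refl) → contradiction (w∈ , ρw , _ , ch) ¬u
                     ; (there w∈us) → w∈us } }) = H′ , reduces-mono (ℕ.m≤n+m _ s) red′ , bnd′

-- Rooting at a fork, and bones along geodesics.

module Bones (G : Graph) {s : ℕ} (star-free : ¬ InducedCopy G (suc (3 + s)) (star (3 + s)))
  (A : ℕ → Set) (family : ∀ i → 2 ≤ i → InducedCopy G (i + 4) (bone i) → A i) where
  open Ranks G public
  open StarFree star-free public

  whole : List V
  whole = allFin (n G)

  size-A : ∀ {L} → InducedCopy G (suc (suc L) + 4) (bone (suc (suc L))) → A (suc (suc L))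
  size-A = family _ (s≤s (s≤s z≤n))

  -- The leaves `a` and `b` count as roots along with `r`: having rank 0, they survive every
  -- reduction, and so does the fork.
  record Rooted (ρ : V → ℕ) (H : List V) (r a b : V) : Set where
    field
      layered : Layered ρ H
      r∈      : r ∈ H
      fork    : Fork H r a b
      ρr      : ρ r ≡ 0
      ρa      : ρ a ≡ 0
      ρb      : ρ b ≡ 0
      roots   : ∀ {z} → z ∈ H → ρ z ≡ 0 → z ∈ r ∷ a ∷ b ∷ []

    root-or-pendent : ∀ {z} → z ∈ H → ρ z ≡ 0 → z ≡ r ⊎ Pendent H r z
    root-or-pendent z∈ eq with roots z∈ eq
    ... | here z≡r = inj₁ z≡r
    ... | there (here refl) = inj₂ (Fork.left fork)
    ... | there (there (here refl)) = inj₂ (Fork.right fork)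

  rooted-reduces : ∀ {ρ H k H′ r a b} → Rooted ρ H r a b → Reduces ρ H k H′ → Rooted ρ H′ r a b
  rooted-reduces R red = record
    { layered = layered
    ; r∈ = keep r∈ ρr
    ; fork = Fork-⊆ sub (keep (Pendent.mem (Fork.left fork)) ρa) (keep (Pendent.mem (Fork.right fork)) ρb) fork
    ; ρr = ρr ; ρa = ρa ; ρb = ρb
    ; roots = roots ∘ sub }
    where
    open Rooted R hiding (layered)
    open Reduces red

  walk-along : ∀ {R u v} → Reach G u v → ∀ k → Walk whole R k u → ∃ λ l → Walk whole R l v
  walk-along here k w = k , w
  walk-along (Reach.step e p) k w = walk-along p (suc k) (_ , w , e , ∈-allFin _)

  record Start : Set where
    field
      {H}     : List V
      {ρ}     : V → ℕ
      {r a b} : V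
      rooted  : Rooted ρ H r a b
      cost    : ∀ {c} → Fits H c → Fits whole c

  start : Connected G → V → Fits whole (suc s) ⊎ Start
  start conn r₀ = go (descend K (s≤s z≤n) layered λ v∈ → ℕ.≤-trans (K-bound v∈) (ℕ.m≤m+n K 1))
    where
    open Ranking (ranking {whole} {r₀ ∷ []} (Unique.allFin⁺ (n G)) (λ _ → ∈-allFin _)
      (λ {v} _ → walk-along (conn r₀ v) 0 (here refl)))
    K : ℕ
    K = proj₁ (bounded ρ whole)
    K-bound : ∀ {v} → v ∈ whole → ρ v ≤ K
    K-bound = proj₂ (bounded ρ whole)
    go : (∃ λ H′ → Reduces ρ whole 0 H′ ×
           (Bounded {ρ} H′ 1 ⊎ ∃ λ u → u ∈ H′ × 1 ≤ ρ u × Star {ρ} H′ u)) → Fits whole (suc s) ⊎ Start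
    go (H , red , inj₁ bnd) = inj₁ (Reduces.cost red (fits-bounded (Reduces.layered red) bnd
      (Reduces.keep red (∈-allFin r₀) (root⇒0 (here refl))) (root⇒0 (here refl))
      λ z∈ eq → case 0⇒root (Reduces.sub red z∈) eq of λ { (here z≡r) → inj₁ z≡r }))
    go (H , red , inj₂ (u , u∈ , _ , st)) = inj₂ record
      { rooted = record
        { layered = New.layered ; r∈ = u∈ ; fork = Star.fork st
        ; ρr = New.root⇒0 (here refl)
        ; ρa = New.root⇒0 (there (here refl))
        ; ρb = New.root⇒0 (there (there (here refl)))
        ; roots = New.0⇒root }
      ; cost = Reduces.cost red }
      where
      R : List V
      R = u ∷ Star.x st ∷ Star.y st ∷ []
      R⊆ : R ⊆ H
      R⊆ (here refl) = u∈
      R⊆ (there (here refl)) = Pendent.mem (Fork.left (Star.fork st))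
      R⊆ (there (there (here refl))) = Pendent.mem (Fork.right (Star.fork st))
      lay : Layered ρ H
      lay = Reduces.layered red
      -- Parents lead from the new root `u` to `r₀`, the only vertex of old rank 0, and from `r₀`
      -- every vertex of `H` is reached.
      r₀-reached : ∃ λ k → Walk H R k r₀
      r₀-reached with z , k , z∈ , ρz , w ← walk-to-root lay {R} (ρ u) {l = 0} u∈ refl (here refl)
        with here refl ← 0⇒root (Reduces.sub red z∈) ρz = k , w
      reach : ∀ {v} → v ∈ H → ∃ λ k → Walk H R k v
      reach {v} v∈ = walk-from-roots lay
        (λ z∈ ρz → case 0⇒root (Reduces.sub red z∈) ρz of λ { (here refl) → r₀-reached }) (ρ v) v∈ refl
      module New = Ranking (ranking (Layered.unique lay) R⊆ reach)

  module _ {ρ H r a b} (R : Rooted ρ H r a b) where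
    open Rooted R

    -- If the geodesic began at a leaf of the fork, its next vertex would be `r`, which has rank 0
    -- instead of 1.
    geodesic-root : ∀ {u L} (g : Geodesic ρ H u (suc L)) → Geodesic.at g 0 ≡ r
    geodesic-root g with root-or-pendent (inside z≤n) (rank z≤n)
      where open Geodesic g
    ... | inj₁ eq = eq
    ... | inj₂ p = contradiction
      (trans (sym (rank (s≤s z≤n))) (trans (cong ρ (Pendent.only p (inside (s≤s z≤n)) (~-sym (step path (s≤s z≤n))))) ρr))
      ℕ.1+n≢0
      where open Geodesic g

    -- The geodesic from `r` to `u` joins two forks; it has one vertex more than the rank of `u`.
    star-bone : ∀ {u x y k} → u ∈ H → ρ u ≡ suc k → Fork H u x y → A (suc (suc k))
    star-bone {u} {x} {y} {k} u∈ ρu F = size-A (fork-bone path inside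
      (subst (λ z → Fork H z a b) (sym (geodesic-root g)) fork)
      (subst (λ z → Fork H z x y) (sym at-end) F))
      where
      g : Geodesic ρ H u (suc k)
      g = geodesic layered u∈ ρu
      open Geodesic g

  -- The path w e, …, w 0 is attached to the path v through w 0 only; together with the part of v
  -- between v 0 and the first neighbour of w 0 it carries a bone.
  branch : ∀ {H v w L e a b x y c} → IndPath v L → (∀ {a} → a ≤ L → v a ∈ H) → Fork H (v 0) a b →
    IndPath w e → (∀ {k} → k ≤ e → w k ∈ H) → Fork H (w e) x y →
    (∀ {c} → c ≤ L → w 0 ≢ v c) → (∀ {k c} → suc k ≤ e → c ≤ L → Far (w (suc k)) (v c)) →
    c ≤ L → w 0 ~ v c →
    Σ (Least λ c → w 0 ~ v c) λ α → value α ≤ L × A (suc (suc (e + value α)))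
  branch {H} {v} {w} {L} {e} {a} {b} {x} {y} P v∈ F W w∈ F′ off far′ c≤ w~ = α , α≤ , size-A (fork-bone
    (join-path W (reverse (prefix P α≤)) (holds α) near (λ {_} {j} k≤ _ → far′ k≤ (v≤ j)))
    (λ i≤ → inside (join-elem w q e i≤))
    (subst (λ z → Fork H z x y) (sym (join-head w q e)) F′)
    (subst (λ z → Fork H z a b) (sym (trans (join-last w q e (value α)) (cong v (ℕ.n∸n≡0 (value α))))) F))
    where
    α : Least λ c → w 0 ~ v c
    α = least (λ c → w 0 ~? v c) w~
    α≤ : value α ≤ L
    α≤ = ℕ.≤-trans (≤-value α w~) c≤
    q : ℕ → V
    q j = v (value α ∸ j)
    v≤ : ∀ j → value α ∸ j ≤ L
    v≤ j = ℕ.≤-trans (ℕ.m∸n≤m (value α) j) α≤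
    near : ∀ {j} → suc j ≤ value α → Far (w 0) (q (suc j))
    near {j} j< = off (v≤ (suc j)) , minimal α (ℕ.∸-monoʳ-< {o = 0} (s≤s z≤n) j<)
    inside : ∀ {z} → (∃ λ k → k ≤ e × z ≡ w k) ⊎ (∃ λ j → j ≤ value α × z ≡ q j) → z ∈ H
    inside (inj₁ (k , k≤ , refl)) = w∈ k≤
    inside (inj₂ (j , _ , refl)) = v∈ (v≤ j)

  module _ {ρ : V → ℕ} {H : List V} {v : ℕ → V} {L : ℕ} {d : V}
    (lip : ∀ {x y} → x ∈ H → y ∈ H → x ~ y → ρ y ≤ suc (ρ x)) (v∈ : ∀ {a} → a ≤ L → v a ∈ H) (ρv : ∀ {a} → a ≤ L → ρ (v a) ≡ a)
    (d∈ : d ∈ H) (α : Least λ c → d ~ v c) (β : Least λ c → d ~ v (L ∸ c))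
    (α≤ : value α ≤ L) (β≤ : value β ≤ L) where

    -- The last neighbour of `d` on the path, at `L ∸ value β`, does not precede the first, at
    -- `value α`.
    α+β≤L : value α + value β ≤ L
    α+β≤L = subst (value α + value β ≤_) (ℕ.m∸n+n≡m β≤)
      (ℕ.+-monoˡ-≤ (value β) (≤-value α (holds β)))

    -- The first and the last neighbour are both adjacent to `d`, so their ranks, which are their
    -- positions, differ by at most two.
    L≤2+α+β : L ≤ suc (suc (value α + value β))
    L≤2+α+β = subst (_≤ suc (suc (value α + value β))) (ℕ.m∸n+n≡m β≤) (ℕ.+-monoˡ-≤ (value β) close)
      where
      close : L ∸ value β ≤ suc (suc (value α))
      close = subst₂ (λ x y → x ≤ suc (suc y)) (ρv {L ∸ value β} (ℕ.m∸n≤m L (value β))) (ρv {value α} α≤)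
        (ℕ.≤-trans (lip d∈ (v∈ {L ∸ value β} (ℕ.m∸n≤m L (value β))) (holds β))
          (s≤s (lip (v∈ {value α} α≤) d∈ (~-sym (holds α)))))

-- Statement (1): a single bone order.

module OneLength (G : Graph) {s : ℕ} (star-free : ¬ InducedCopy G (suc (3 + s)) (star (3 + s))) (p : ℕ)
  (family : ∀ i → 2 ≤ i → InducedCopy G (i + 4) (bone i) → i ≡ 2 * suc p) where
  open Bones G star-free (λ i → i ≡ 2 * suc p) family

  -- The rank of stuck vertices. The order of the bones is `2 * suc p` here, so this is that order
  -- minus one.
  L : ℕ
  L = suc (p + p)

  sucL≡ : suc L ≡ 2 * suc p
  sucL≡ = solve 1 (λ p → con 2 :+ (p :+ p) := con 2 :* (con 1 :+ p)) refl p
    where open +-*-Solver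

  -- The equal bone orders give `α ≡ β`; the odd number `L` lies between `α + α` and `α + α + 2`,
  -- which leaves only `α ≡ p`.
  half : ∀ {e α β} → suc (suc (e + α)) ≡ 2 * suc p → suc (suc (e + β)) ≡ 2 * suc p →
    α + β ≤ L → L ≤ suc (suc (α + β)) → e ≡ p × α ≡ p × β ≡ p
  half {e} {α} {β} eα eβ ≤L L≤ with refl ← ℕ.+-cancelˡ-≡ e α β (ℕ.suc-injective (ℕ.suc-injective (trans eα (sym eβ)))) =
    e≡p , α≡p , α≡p
    where
    double-< : ∀ {x y} → x < y → suc (suc (x + x)) ≤ y + y
    double-< {x} {y} lt = subst (_≤ y + y) (cong suc (ℕ.+-suc x x)) (ℕ.+-mono-≤ lt lt)
    α≡p : α ≡ p
    α≡p = ℕ.≤-antisym (ℕ.≮⇒≥ λ p<α → ℕ.1+n≰n (ℕ.≤-trans (double-< p<α) ≤L))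
                      (ℕ.≮⇒≥ λ α<p → ℕ.1+n≰n (ℕ.≤-trans L≤ (double-< α<p)))
    e≡p : e ≡ p
    e≡p = ℕ.+-cancelʳ-≡ p e p (ℕ.suc-injective (ℕ.suc-injective
      (trans (subst (λ α → suc (suc (e + α)) ≡ 2 * suc p) α≡p eα) (sym sucL≡))))

  L∸p : L ∸ p ≡ suc p
  L∸p = trans (cong (_∸ p) (sym (ℕ.+-suc p p))) (ℕ.m+n∸m≡n p (suc p))

  -- The two bones from u′ along its geodesic to the first vertex d near the geodesic of u, and on to
  -- r and to u, have equal size; as the neighbours of d on a geodesic are at most two apart, d is the
  -- vertex of rank suc p.
  meet : ∀ {ρ H r a b u x y u′ x′ y′} → Rooted ρ H r a b →
    (g : Geodesic ρ H u L) (g′ : Geodesic ρ H u′ L) → Fork H u x y → Fork H u′ x′ y′ → u ≢ u′ →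
    let open Geodesic in at g′ (suc p) ~ at g p × at g′ (suc p) ~ at g (suc p)
  meet {ρ} {H} {r} {a} {b} {u} {x} {y} {u′} {x′} {y′} R g g′ F F′ u≢u′ =
    subst₂ (λ i j → at g′ i ~ at g j) position α≡p (holds α)
    , subst₂ (λ i j → at g′ i ~ at g j) position (trans (cong (L ∸_) β≡p) L∸p) (holds β)
    where
    open Geodesic
    open Rooted R
    v z : ℕ → V
    v = at g
    z k = at g′ (L ∸ k)
    Near : ℕ → Set
    Near k = ∃ λ c → c < suc L × z k ~ v c
    -- The vertex of rank 1 on `g′` is adjacent to `r`, where both geodesics start.
    near-root : Near (p + p)
    near-root = 0 , s≤s z≤n , subst₂ (λ i j → at g′ i ~ j) (sym L∸)
      (trans (geodesic-root R g′) (sym (geodesic-root R g))) (~-sym (step (path g′) (s≤s z≤n)))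
      where
      L∸ : L ∸ (p + p) ≡ 1
      L∸ = trans (ℕ.+-∸-assoc 1 {p + p} ℕ.≤-refl) (cong suc (ℕ.n∸n≡0 (p + p)))
    first : Least Near
    first = least {Near} (λ k → ℕ.anyUpTo? (λ c → z k ~? v c) (suc L)) {p + p} near-root
    e : ℕ
    e = value first
    e≤L : e ≤ L
    e≤L = ℕ.m≤n⇒m≤1+n (≤-value first near-root)
    -- The end `z 0` could only meet `g` in the vertex of rank `L`, which is `u`; a later vertex on
    -- `g` would make its predecessor near already.
    off : ∀ {k c} → k ≤ e → c ≤ L → z k ≢ v c
    off {zero} {c} _ c≤ eq = u≢u′ (trans (sym (at-end g)) (trans (cong v (sym c≡L)) (trans (sym eq) (at-end g′))))
      where
      c≡L : c ≡ L
      c≡L = trans (sym (rank g c≤)) (trans (cong ρ (sym eq)) (rank g′ ℕ.≤-refl))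
    off {suc k} {c} k< c≤ eq = minimal first k< (c , s≤s c≤ ,
      subst (z k ~_) eq (step (reverse (path g′)) (ℕ.≤-trans k< e≤L)))
    -- Reversed, so that `w 0` is the contact vertex `d` and `w e` is `u′`, as `branch` expects.
    w : ℕ → V
    w k = z (e ∸ k)
    w-path : IndPath w e
    w-path = reverse (prefix (reverse (path g′)) e≤L)
    w∈ : ∀ {k} → k ≤ e → w k ∈ H
    w∈ {k} _ = inside g′ (ℕ.m∸n≤m L (e ∸ k))
    w-end : w e ≡ u′
    w-end = trans (cong z (ℕ.n∸n≡0 e)) (at-end g′)
    far-w : ∀ {k c} → suc k ≤ e → c ≤ L → Far (w (suc k)) (v c)
    far-w {k} {c} k< c≤ = off (ℕ.m∸n≤m e (suc k)) c≤ ,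
      λ w~v → minimal first (ℕ.∸-monoʳ-< {o = 0} (s≤s z≤n) k<) (c , s≤s c≤ , w~v)
    far-w′ : ∀ {k c} → suc k ≤ e → c ≤ L → Far (w (suc k)) (v (L ∸ c))
    far-w′ {c = c} k< _ = far-w k< (ℕ.m∸n≤m L c)
    F-root : Fork H (v 0) a b
    F-root = subst (λ z → Fork H z a b) (sym (geodesic-root R g)) fork
    F-u : Fork H (v L) x y
    F-u = subst (λ z → Fork H z x y) (sym (at-end g)) F
    F-w : Fork H (w e) x′ y′
    F-w = subst (λ z → Fork H z x′ y′) (sym w-end) F′
    c₀ : ℕ
    c₀ = proj₁ (holds first)
    c₀≤L : c₀ ≤ L
    c₀≤L = s≤s⁻¹ (proj₁ (proj₂ (holds first)))
    d~ : w 0 ~ v c₀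
    d~ = proj₂ (proj₂ (holds first))
    to-r : Σ (Least λ c → w 0 ~ v c) λ α → value α ≤ L × suc (suc (e + value α)) ≡ 2 * suc p
    to-r = branch (path g) (inside g) F-root w-path w∈ F-w (off ℕ.≤-refl) far-w c₀≤L d~
    to-u : Σ (Least λ c → w 0 ~ v (L ∸ c)) λ β → value β ≤ L × suc (suc (e + value β)) ≡ 2 * suc p
    to-u = branch (reverse (path g)) (λ {c} _ → inside g (ℕ.m∸n≤m L c)) F-u w-path w∈ F-w
      (λ {c} _ → off ℕ.≤-refl (ℕ.m∸n≤m L c)) far-w′ (ℕ.m∸n≤m L c₀)
      (subst (λ c → w 0 ~ v c) (sym (ℕ.m∸[m∸n]≡n c₀≤L)) d~)
    α : Least λ c → w 0 ~ v c
    α = proj₁ to-r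
    β : Least λ c → w 0 ~ v (L ∸ c)
    β = proj₁ to-u
    middle : e ≡ p × value α ≡ p × value β ≡ p
    middle = half (proj₂ (proj₂ to-r)) (proj₂ (proj₂ to-u))
      (α+β≤L {ρ} (Layered.lipschitz layered) (inside g) (rank g) (w∈ z≤n) α β (proj₁ (proj₂ to-r)) (proj₁ (proj₂ to-u)))
      (L≤2+α+β {ρ} (Layered.lipschitz layered) (inside g) (rank g) (w∈ z≤n) α β (proj₁ (proj₂ to-r)) (proj₁ (proj₂ to-u)))
    α≡p : value α ≡ p
    α≡p = proj₁ (proj₂ middle)
    β≡p : value β ≡ p
    β≡p = proj₂ (proj₂ middle)
    position : L ∸ e ≡ suc p
    position = trans (cong (L ∸_) (proj₁ middle)) L∸p

  -- The vertices of rank `suc p` on `suc m` geodesics and the vertex of rank `p` on the first one.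
  -- Adjacency comes from `meet`, except for the edge inside the first geodesic; adjacent vertices
  -- are distinct.
  clique : ∀ {ρ H r a b} → Rooted ρ H r a b → ∀ us → Unique us →
    (∀ {u} → u ∈ us → u ∈ H × ρ u ≡ L × Star {ρ} H u) →
    ∀ {m} → m < length us → HasClique G (suc (suc m))
  clique {ρ} {H} R us uniq good {m} m< = f , f-injective , λ i j i≢j → f-adj i j i≢j
    where
    open Geodesic
    index₀ : Fin (suc m) → Fin (length us)
    index₀ i = inject≤ i m<
    end : Fin (suc m) → V
    end i = lookup us (index₀ i)
    good-end : ∀ i → end i ∈ H × ρ (end i) ≡ L × Star {ρ} H (end i)
    good-end i = good (∈-lookup (index₀ i))
    g : ∀ i → Geodesic ρ H (end i) L
    g i = geodesic (Rooted.layered R) (proj₁ (good-end i)) (proj₁ (proj₂ (good-end i)))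
    fork : ∀ i → Fork H (end i) _ _
    fork i = Star.fork (proj₂ (proj₂ (good-end i)))
    meets : ∀ i j → i ≢ j → at (g j) (suc p) ~ at (g i) p × at (g j) (suc p) ~ at (g i) (suc p)
    meets i j i≢j = meet R (g i) (g j) (fork i) (fork j)
      λ eq → i≢j (inject≤-injective m< m< i j (lookup-injective uniq eq))
    centre : ∀ j → at (g j) (suc p) ~ at (g zero) p
    centre zero = ~-sym (step (path (g zero)) (s≤s (ℕ.m≤m+n p p)))
    centre (suc j) = proj₁ (meets zero (suc j) λ ())
    f : Fin (suc (suc m)) → V
    f zero = at (g zero) p
    f (suc i) = at (g i) (suc p)
    f-adj : ∀ i j → i ≢ j → f i ~ f j
    f-adj zero zero i≢j = contradiction refl i≢j
    f-adj zero (suc j) _ = ~-sym (centre j)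
    f-adj (suc i) zero _ = centre i
    f-adj (suc i) (suc j) i≢j = ~-sym (proj₂ (meets i j (i≢j ∘ cong suc)))
    f-injective : Injective _≡_ _≡_ f
    f-injective {i} {j} eq = decidable-stable (i ≟ j) λ i≢j → ~-irrefl (f-adj i j i≢j) eq

  star-rank : ∀ {ρ H r a b u} → Rooted ρ H r a b → u ∈ H → 1 ≤ ρ u → Star {ρ} H u → ρ u ≡ L
  star-rank {ρ} {u = u} R u∈ 1≤ st = go (ρ u) refl 1≤
    where
    go : ∀ k → ρ u ≡ k → 1 ≤ k → ρ u ≡ L
    go (suc k) eq _ = trans eq (ℕ.suc-injective (trans (star-bone R u∈ eq (Star.fork st)) (sym sucL≡)))

  fits-whole : ∀ {m} → Connected G → V → ¬ HasClique G (suc (suc m)) → Fits whole (suc m * s + 1)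
  fits-whole {m} conn r₀ no-clique with start conn r₀
  ... | inj₁ fits = fits-mono (subst (_≤ suc m * s + 1) (ℕ.+-comm s 1)
          (ℕ.+-monoˡ-≤ 1 (ℕ.m≤m+n s (m * s)))) fits
  ... | inj₂ st = cost (Reduces.cost red₁ (Reduces.cost red₂ (fits-mono bound (Reduces.cost red₃
          (Reduces.cost red₄ last)))))
    where
    open Start st
    K-bounded : ∃ λ K → ∀ {v} → v ∈ H → ρ v ≤ K
    K-bounded = bounded ρ H
    above : ∃ λ H′ → Reduces ρ H 0 H′ × (Bounded {ρ} H′ (suc L) ⊎ ∃ λ u → u ∈ H′ × suc L ≤ ρ u × Star {ρ} H′ u)
    above = descend (proj₁ K-bounded) (s≤s z≤n) (Rooted.layered rooted)
      λ v∈ → ℕ.≤-trans (proj₂ K-bounded v∈) (ℕ.m≤m+n _ (suc L))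
    H₁ : List V
    H₁ = proj₁ above
    red₁ : Reduces ρ H 0 H₁
    red₁ = proj₁ (proj₂ above)
    -- A star of rank above `L` contradicts `star-rank`, so the descent must have reached rank
    -- `suc L`.
    bnd₁ : Bounded {ρ} H₁ (suc L)
    bnd₁ = [ (λ bnd → bnd) , (λ { (u , u∈ , L< , star) → contradiction L<
      (ℕ.<-irrefl (sym (star-rank (rooted-reduces rooted red₁) u∈ (ℕ.≤-trans (s≤s z≤n) L<) star))) }) ]′
      (proj₂ (proj₂ above))
    level : ∃ λ H′ → Reduces ρ H₁ 0 H′ × Stuck {ρ} L H′
    level = reduce (length H₁) ℕ.≤-refl (Reduces.layered red₁) bnd₁
    H₂ : List V
    H₂ = proj₁ level
    red₂ : Reduces ρ H₁ 0 H₂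
    red₂ = proj₁ (proj₂ level)
    stuck₂ : Stuck {ρ} L H₂
    stuck₂ = proj₂ (proj₂ level)
    rooted₂ : Rooted ρ H₂ r a b
    rooted₂ = rooted-reduces (rooted-reduces rooted red₁) red₂
    Forked : V → Set
    Forked u = ρ u ≡ L × ∃ λ v → Child {ρ} H₂ u v
    forked? : ∀ u → Dec (Forked u)
    forked? u = (ρ u ℕ.≟ L) ×-dec any? (child? {ρ} H₂ u)
    us : List V
    us = filter forked? H₂
    us-length : length us ≤ m
    us-length = ℕ.≮⇒≥ λ m< → no-clique (clique rooted₂ us (Unique.filter⁺ forked? (Layered.unique (Reduces.layered red₂)))
      (λ u∈us → let u∈ , ρu , _ , ch = ∈-filter⁻ forked? {xs = H₂} u∈us in
        u∈ , ρu , Stuck.forked stuck₂ u∈ ρu (s≤s z≤n) ch) m<)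
    peeled : ∃ λ H′ → Reduces ρ H₂ (length us * s) H′ × Bounded {ρ} H′ L
    peeled = peel-all us (Reduces.layered red₂) (bnd₁ ∘ Reduces.sub red₂) (Stuck.independent stuck₂)
      λ u∈ ρu ch → ∈-filter⁺ forked? u∈ (ρu , _ , ch)
    H₃ : List V
    H₃ = proj₁ peeled
    red₃ : Reduces ρ H₂ (length us * s) H₃
    red₃ = proj₁ (proj₂ peeled)
    below : ∃ λ H′ → Reduces ρ H₃ 0 H′ × (Bounded {ρ} H′ 1 ⊎ ∃ λ u → u ∈ H′ × 1 ≤ ρ u × Star {ρ} H′ u)
    below = descend (p + p) (s≤s z≤n) (Reduces.layered red₃)
      λ {v} v∈ → subst (ρ v ≤_) (sym (ℕ.+-comm (p + p) 1)) (proj₂ (proj₂ peeled) v∈)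
    H₄ : List V
    H₄ = proj₁ below
    red₄ : Reduces ρ H₃ 0 H₄
    red₄ = proj₁ (proj₂ below)
    rooted₄ : Rooted ρ H₄ r a b
    rooted₄ = rooted-reduces (rooted-reduces rooted₂ red₃) red₄
    -- A star would have rank `L` and leaves of rank `suc L`, but peeling has emptied that rank.
    bnd₄ : Bounded {ρ} H₄ 1
    bnd₄ = [ (λ bnd → bnd) , (λ { (u , u∈ , 1≤ , star) → contradiction
      (subst (_≤ L) (trans (Star.ρx star) (cong suc (star-rank rooted₄ u∈ 1≤ star)))
        (proj₂ (proj₂ peeled) (Reduces.sub red₄ (Pendent.mem (Fork.left (Star.fork star))))))
      ℕ.1+n≰n }) ]′ (proj₂ (proj₂ below))
    last : Fits H₄ (suc s)
    last = fits-bounded (Rooted.layered rooted₄) bnd₄ (Rooted.r∈ rooted₄) (Rooted.ρr rooted₄)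
      (Rooted.root-or-pendent rooted₄)
    bound : length us * s + suc s ≤ suc m * s + 1
    bound = ℕ.≤-trans (ℕ.+-monoˡ-≤ (suc s) (ℕ.*-monoˡ-≤ s us-length))
      (ℕ.≤-reflexive (solve 2 (λ m s → m :* s :+ (con 1 :+ s) := (s :+ m :* s) :+ con 1) refl m s))
      where open +-*-Solver

-- Statement (2): all even bone orders, no triangle.

module EvenLengths (G : Graph) {s : ℕ} (star-free : ¬ InducedCopy G (suc (3 + s)) (star (3 + s)))
  (family : ∀ i → 2 ≤ i → InducedCopy G (i + 4) (bone i) → ∃ λ k → i ≡ 2 * k) (no-triangle : ¬ HasClique G 3) where
  open Bones G star-free (λ i → ∃ λ k → i ≡ 2 * k) family

  triangle-free : ∀ {x y z} → x ~ y → y ~ z → ¬ x ~ z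
  triangle-free {x} {y} {z} xy yz xz = no-triangle (f , injective , f-adj)
    where
    f : Fin 3 → V
    f zero = x
    f (suc zero) = y
    f (suc (suc zero)) = z
    f-adj : ∀ i j → i ≢ j → f i ~ f j
    f-adj zero zero ne = contradiction refl ne
    f-adj zero (suc zero) _ = xy
    f-adj zero (suc (suc zero)) _ = xz
    f-adj (suc zero) zero _ = ~-sym xy
    f-adj (suc zero) (suc zero) ne = contradiction refl ne
    f-adj (suc zero) (suc (suc zero)) _ = yz
    f-adj (suc (suc zero)) zero _ = ~-sym xz
    f-adj (suc (suc zero)) (suc zero) _ = ~-sym yz
    f-adj (suc (suc zero)) (suc (suc zero)) ne = contradiction refl ne
    injective : Injective _≡_ _≡_ f
    injective {i} {j} eq = decidable-stable (i ≟ j) λ ne → ~-irrefl (f-adj i j ne) eq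

  Even : ℕ → Set
  Even i = ∃ λ k → i ≡ 2 * k

  even-+ : ∀ {a b} → Even a → Even b → Even (a + b)
  even-+ (k , refl) (l , refl) = k + l , sym (ℕ.*-distribˡ-+ 2 k l)

  -- Consecutive vertices are paired from the far end. The form `l * 2` unfolds by two successors
  -- for each `suc l`.
  fits-path : ∀ {v L} → IndPath v L → ∀ l {H} → l * 2 ≤ L → Unique H →
    (∀ {c} → 1 ≤ c → c ≤ l * 2 → v c ∈ H) →
    (∀ {z} → z ∈ H → ∃ λ c → 1 ≤ c × c ≤ l * 2 × z ≡ v c) → Fits H 0
  fits-path P zero l≤ uniq v∈ cover = fits-empty (empty-length λ z∈ → case cover z∈ of
    λ { (_ , 1≤ , c≤ , _) → contradiction (ℕ.≤-trans 1≤ c≤) λ () })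
  fits-path {v} {L} P (suc l) {H} l≤ uniq v∈ cover =
    fits-∖ uniq (v∈ (s≤s z≤n) ℕ.≤-refl) (v∈ (s≤s z≤n) (ℕ.n≤1+n _)) (here refl) (there (here refl))
      (~-sym (step P l≤)) ℕ.≤-refl
      (fits-path P l l*2≤ (Unique.filter⁺ _ uniq)
        (λ 1≤ c≤ → ∈-∖⁺ (v∈ 1≤ (ℕ.≤-trans c≤ (ℕ.≤-trans (ℕ.n≤1+n _) (ℕ.n≤1+n _))))
          λ { (here eq) → path-<⇒≢ P (s≤s (ℕ.m≤n⇒m≤1+n c≤)) l≤ eq
            ; (there (here eq)) → path-<⇒≢ P (s≤s c≤) (ℕ.≤-trans (ℕ.n≤1+n _) l≤) eq })
        λ {z} z∈ → inner z∈ (cover (proj₁ (∈-∖⁻ H X z∈))))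
    where
    X : List V
    X = v (suc (suc (l * 2))) ∷ v (suc (l * 2)) ∷ []
    l*2≤ : l * 2 ≤ L
    l*2≤ = ℕ.≤-trans (ℕ.≤-trans (ℕ.n≤1+n _) (ℕ.n≤1+n _)) l≤
    inner : ∀ {z} → z ∈ H ∖ X → (∃ λ c → 1 ≤ c × c ≤ suc l * 2 × z ≡ v c) → ∃ λ c → 1 ≤ c × c ≤ l * 2 × z ≡ v c
    inner z∈ (c , 1≤ , c≤ , eq) with ℕ.m≤n⇒m<n∨m≡n c≤
    ... | inj₂ refl = contradiction (here eq) (proj₂ (∈-∖⁻ H X z∈))
    ... | inj₁ c< with ℕ.m≤n⇒m<n∨m≡n (s≤s⁻¹ c<)
    ...   | inj₂ refl = contradiction (there (here eq)) (proj₂ (∈-∖⁻ H X z∈))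
    ...   | inj₁ c<′ = c , 1≤ , s≤s⁻¹ c<′ , eq

  -- A ρ-geodesic v between two forks of H; σ ranks H from the geodesic and the four pendent vertices.
  record Spine (H : List V) : Set where
    field
      {ρ σ}     : V → ℕ
      {a b x y} : V
      v         : ℕ → V
      k         : ℕ
    L : ℕ
    L = suc k
    field
      path    : IndPath v L
      v∈      : ∀ {c} → c ≤ L → v c ∈ H
      ρv      : ∀ {c} → c ≤ L → ρ (v c) ≡ c
      forkᵣ   : Fork H (v 0) a b
      forkᵤ   : Fork H (v L) x y
      ρ-lip   : ∀ {x y} → x ∈ H → y ∈ H → x ~ y → ρ y ≤ suc (ρ x)
      σ-layer : Layered σ H
      σv      : ∀ {c} → c ≤ L → σ (v c) ≡ 0
      σ-roots : ∀ {z} → z ∈ H → σ z ≡ 0 → (∃ λ c → c ≤ L × z ≡ v c) ⊎ Pendent H (v 0) z ⊎ Pendent H (v L) z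

  module OnSpine {H} (S : Spine H) where
    open Spine S

    -- The spine with its two forks is itself a bone, so its number of vertices is even.
    half : ℕ
    half = proj₁ (size-A (fork-bone path v∈ forkᵣ forkᵤ))

    L-odd : suc L ≡ 2 * half
    L-odd = proj₂ (size-A (fork-bone path v∈ forkᵣ forkᵤ))

    path⁻ : IndPath (λ c → v (L ∸ c)) L
    path⁻ = reverse path

    v⁻∈ : ∀ {c} → c ≤ L → v (L ∸ c) ∈ H
    v⁻∈ {c} _ = v∈ (ℕ.m∸n≤m L c)

    forkᵣ⁻ : Fork H (v (L ∸ L)) a b
    forkᵣ⁻ = subst (λ c → Fork H (v c) a b) (sym (ℕ.n∸n≡0 L)) forkᵣ

    off : ∀ {d} → 1 ≤ σ d → ∀ {c} → c ≤ L → d ≢ v c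
    off 1≤ c≤ refl = ℕ.<⇒≢ 1≤ (sym (σv c≤))

    -- A pendent root is adjacent only to an end of the spine, so a vertex of positive rank next to
    -- a root is next to the spine.
    v~⇒ : ∀ {d z} → d ∈ H → 1 ≤ σ d → z ∈ H → σ z ≡ 0 → z ~ d → ∃ λ c → c ≤ L × d ~ v c
    v~⇒ d∈ 1≤ z∈ σz e with σ-roots z∈ σz
    ... | inj₁ (c , c≤ , refl) = c , c≤ , ~-sym e
    ... | inj₂ (inj₁ p) = contradiction (Pendent.only p d∈ (~-sym e)) (off 1≤ z≤n)
    ... | inj₂ (inj₂ p) = contradiction (Pendent.only p d∈ (~-sym e)) (off 1≤ ℕ.≤-refl)

    -- The extreme neighbours of d on the spine are at most two apart, and at odd distance: a triangle.
    squeeze : ∀ {d} → d ∈ H → (α : Least λ c → d ~ v c) (β : Least λ c → d ~ v (L ∸ c)) →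
      value α ≤ L → value β ≤ L → ∀ h → Even (value α + value β + 2 * h) → ⊥
    squeeze {d} d∈ α β α≤ β≤ h (m , even) with ℕ.m≤n⇒m<n∨m≡n (α+β≤L {ρ} ρ-lip v∈ ρv d∈ α β α≤ β≤)
    ... | inj₂ eq = ℕ.even≢odd (half + h) m (trans
            (ℕ.*-distribˡ-+ 2 half h) (trans (cong (_+ 2 * h) (sym L-odd)) (cong suc (trans (cong (_+ 2 * h) (sym eq)) even))))
    ... | inj₁ lt with ℕ.m≤n⇒m<n∨m≡n lt
    ...   | inj₂ eq = triangle-free (holds α) (step path (subst (suc (value α) ≤_) eq (s≤s (ℕ.m≤m+n _ _))))
              (subst (λ c → d ~ v c) (trans (cong (_∸ value β) (sym eq)) (ℕ.m+n∸n≡m (suc (value α)) (value β))) (holds β))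
    ...   | inj₁ lt′ = ℕ.even≢odd (half + h) (suc m) (trans
            (ℕ.*-distribˡ-+ 2 half h) (trans (cong (_+ 2 * h) (sym L-odd)) (cong suc
              (trans (cong (_+ 2 * h) (sym eq)) (trans (cong (λ k → suc (suc k)) even) (sym (ℕ.*-distribˡ-+ 2 1 m)))))))
      where
      eq : suc (suc (value α + value β)) ≡ L
      eq = ℕ.≤-antisym lt′ (L≤2+α+β {ρ} ρ-lip v∈ ρv d∈ α β α≤ β≤)

    -- Without its root, a `σ`-geodesic to `u` touches the spine through its first vertex `w 0`
    -- only. Continued along the spine in both directions it carries two bones, whose even orders
    -- contradict `squeeze`.
    third-star : ∀ {u} → u ∈ H → 1 ≤ σ u → Star {σ} H u → ⊥
    third-star {u} u∈ 1≤ st = go (σ u) refl 1≤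
      where
      go : ∀ e → σ u ≡ e → 1 ≤ e → ⊥
      go (suc e) eq _ = squeeze (w∈ z≤n) (proj₁ toᵣ) (proj₁ toᵤ) (proj₁ (proj₂ toᵣ)) (proj₁ (proj₂ toᵤ))
        -- The bones have orders `e + α + 2` and `e + β + 2`, with sum `α + β + 2 * (e + 2)`.
        (suc (suc e)) (subst Even (sym
          (solve 3 (λ e α β → α :+ β :+ con 2 :* (con 2 :+ e) := (con 2 :+ (e :+ α)) :+ (con 2 :+ (e :+ β))) refl
            e (value (proj₁ toᵣ)) (value (proj₁ toᵤ))))
          (even-+ (proj₂ (proj₂ toᵣ)) (proj₂ (proj₂ toᵤ))))
        where
        open +-*-Solver
        g : Geodesic σ H u (suc e)
        g = geodesic σ-layer u∈ eq
        open Geodesic g renaming (path to g-path)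
        w : ℕ → V
        w c = at (suc c)
        w-path : IndPath w e
        w-path = record { step = λ lt → step g-path (s≤s lt) ; far = λ lt le → far g-path (s≤s lt) (s≤s le) }
        w∈ : ∀ {c} → c ≤ e → w c ∈ H
        w∈ c≤ = inside (s≤s c≤)
        σw : ∀ {c} → c ≤ e → 1 ≤ σ (w c)
        σw c≤ = subst (1 ≤_) (sym (rank (s≤s c≤))) (s≤s z≤n)
        F : Fork H (w e) (Star.x st) (Star.y st)
        F = subst (λ z → Fork H z _ _) (sym at-end) (Star.fork st)
        far-w : ∀ {i c} → suc i ≤ e → c ≤ L → Far (w (suc i)) (v c)
        far-w i≤ c≤ = Far-sym (rank-gap σ-layer (v∈ c≤) (w∈ i≤)
          (subst₂ (λ m n → suc m < n) (sym (σv c≤)) (sym (rank (s≤s i≤))) (s≤s (s≤s z≤n))))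
        touch : ∃ λ c → c ≤ L × w 0 ~ v c
        touch = v~⇒ (w∈ z≤n) (σw z≤n) (inside z≤n) (rank z≤n) (step g-path (s≤s z≤n))
        c₀≤ : proj₁ touch ≤ L
        c₀≤ = proj₁ (proj₂ touch)
        toᵣ : Σ (Least λ c → w 0 ~ v c) λ α → value α ≤ L × Even (suc (suc (e + value α)))
        toᵣ = branch path v∈ forkᵣ w-path w∈ F (off (σw z≤n)) far-w c₀≤ (proj₂ (proj₂ touch))
        toᵤ : Σ (Least λ c → w 0 ~ v (L ∸ c)) λ β → value β ≤ L × Even (suc (suc (e + value β)))
        toᵤ = branch path⁻ v⁻∈ forkᵤ w-path w∈ F (λ {c} _ → off (σw z≤n) (ℕ.m∸n≤m L c))
          (λ {_} {c} i≤ _ → far-w i≤ (ℕ.m∸n≤m L c)) (ℕ.m∸n≤m L (proj₁ touch))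
          (subst (λ c → w 0 ~ v c) (sym (ℕ.m∸[m∸n]≡n c₀≤)) (proj₂ (proj₂ touch)))

    -- d and the next path vertex are pendent at v α, the first neighbour of d.
    first-neighbour-odd : ∀ {v a b x y d} → IndPath v L → (∀ {c} → c ≤ L → v c ∈ H) →
      Fork H (v 0) a b → Fork H (v L) x y → d ∈ H → (∀ {c} → c ≤ L → d ≢ v c) →
      (α : Least λ c → d ~ v c) → value α < L → ¬ d ~ v 0 → Even (suc (value α))
    first-neighbour-odd {v} {a} {b} {x} {y} {d} P v∈ F F′ d∈ d-off (mkLeast zero d~v0 _) _ d≁v0 = contradiction d~v0 d≁v0
    first-neighbour-odd {v} {a} {b} {x} {y} {d} P v∈ F F′ d∈ d-off (mkLeast (suc α) d~ min) α< _ =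
      size-A (bone-copy (prefix P (ℕ.<⇒≤ α<)) (End-restrict (ℕ.<⇒≤ α<) (fork-End P v∈ F F′)) record
        { x≢y = d-off α<
        ; x≁y = triangle-free d~ (step P α<)
        ; e~x = ~-sym d~
        ; e~y = step P α<
        ; x∉ = λ c≤ → d-off (ℕ.≤-trans c≤ (ℕ.<⇒≤ α<))
        ; y∉ = λ c≤ → ≢-sym (path-<⇒≢ P (s≤s c≤) α<)
        ; x-only = λ c≤ e → ℕ.≤-antisym c≤ (ℕ.≮⇒≥ λ lt → min lt e)
        ; y-only = λ c≤ e → [ (λ { refl → contradiction c≤ (ℕ.<⇒≱ (ℕ.m≤n⇒m≤1+n ℕ.≤-refl)) })
                            , ℕ.suc-injective ]′ (path-adjacent P α< (ℕ.≤-trans c≤ (ℕ.<⇒≤ α<)) e) }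
        (apart-d (Fork.left F)) (apart-v (Fork.left F)) (apart-d (Fork.right F)) (apart-v (Fork.right F)))
      where
      apart-d : ∀ {z} → Pendent H (v 0) z → ¬ z ~ d
      apart-d p e = d-off z≤n (Pendent.only p d∈ (~-sym e))
      apart-v : ∀ {z} → Pendent H (v 0) z → ¬ z ~ v (suc (suc α))
      apart-v p e = path-<⇒≢ P (s≤s z≤n) α< (sym (Pendent.only p (v∈ α<) (~-sym e)))

    -- Otherwise `first-neighbour-odd`, applied from both ends of the spine, makes `suc α` and
    -- `suc β` even, which `squeeze` forbids.
    near-end : ∀ {d} → d ∈ H → σ d ≡ 1 → v 0 ~ d ⊎ v L ~ d
    near-end {d} d∈ σd with v 0 ~? d | v L ~? d
    ... | yes e | _ = inj₁ e
    ... | no _ | yes e = inj₂ e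
    ... | no v0≁ | no vL≁ = ⊥-elim (squeeze d∈ α β (ℕ.<⇒≤ α<) (ℕ.<⇒≤ β<) 1 (subst Even (sym
        (solve 2 (λ α β → α :+ β :+ con 2 := (con 1 :+ α) :+ (con 1 :+ β)) refl (value α) (value β)))
        (even-+
          (first-neighbour-odd path v∈ forkᵣ forkᵤ d∈ (off 1≤) α α< (v0≁ ∘ ~-sym))
          (first-neighbour-odd path⁻ v⁻∈ forkᵤ forkᵣ⁻ d∈ (λ {c} _ → off 1≤ (ℕ.m∸n≤m L c)) β β< (vL≁ ∘ ~-sym)))))
      where
      open +-*-Solver
      1≤ : 1 ≤ σ d
      1≤ = ℕ.≤-reflexive (sym σd)
      touch : ∃ λ c → c ≤ L × d ~ v c
      touch with z , z∈ , e , σz ← Layered.parent σ-layer d∈ σd = v~⇒ d∈ 1≤ z∈ σz e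
      c₀ : ℕ
      c₀ = proj₁ touch
      c₀≤ : c₀ ≤ L
      c₀≤ = proj₁ (proj₂ touch)
      d~ : d ~ v c₀
      d~ = proj₂ (proj₂ touch)
      α : Least λ c → d ~ v c
      α = least (λ c → d ~? v c) d~
      d~⁻ : d ~ v (L ∸ (L ∸ c₀))
      d~⁻ = subst (λ c → d ~ v c) (sym (ℕ.m∸[m∸n]≡n c₀≤)) d~
      β : Least λ c → d ~ v (L ∸ c)
      β = least (λ c → d ~? v (L ∸ c)) {L ∸ c₀} d~⁻
      α< : value α < L
      α< = ℕ.≤∧≢⇒< (ℕ.≤-trans (≤-value α d~) c₀≤)
        λ eq → vL≁ (~-sym (subst (λ c → d ~ v c) eq (holds α)))
      β< : value β < L
      β< = ℕ.≤∧≢⇒< (ℕ.≤-trans (≤-value β {L ∸ c₀} d~⁻) (ℕ.m∸n≤m L c₀))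
        λ eq → v0≁ (~-sym (subst (λ c → d ~ v c) (trans (cong (L ∸_) eq) (ℕ.n∸n≡0 L)) (holds β)))

    Pathlike : V → Set
    Pathlike z = ∃ λ c → c ≤ L × z ≡ v c

    kind : Bounded {σ} H 1 → ∀ {z} → z ∈ H → Pathlike z ⊎ v 0 ~ z ⊎ v L ~ z
    kind bnd z∈ with ℕ.m≤n⇒m<n∨m≡n (bnd z∈)
    ... | inj₂ σz = inj₂ (near-end z∈ σz)
    ... | inj₁ σ< with σ-roots z∈ (ℕ.n<1⇒n≡0 σ<)
    ...   | inj₁ p = inj₁ p
    ...   | inj₂ (inj₁ p) = inj₂ (inj₁ (Pendent.link p))
    ...   | inj₂ (inj₂ p) = inj₂ (inj₂ (Pendent.link p))

    -- Used with `c` an end of the spine and `q` its neighbour on the spine, which is spared for the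
    -- matching of the interior.
    Side : V → V → V → Set
    Side c q z = c ~ z × z ≢ q

    side? : ∀ c q z → Dec (Side c q z)
    side? c q z = c ~? z ×-dec ¬? (z ≟ q)

    -- Without triangles the neighbours of `c` are independent. The spared vertex `q` counts as a
    -- leaf of the star but is not deleted, so the cost at each end is `s` and not `s + 1`.
    side-length : ∀ {c q H′} → Unique H′ → c ~ q → length (c ∷ filter (side? c q) H′) ≤ 2 + s
    side-length {c} {q} {H′} uniq c~q = s≤s⁻¹ (star-free⇒length< star-free
      (All.tabulate (λ z∈ → ≢-sym (proj₂ (sides z∈))) ∷ Unique.filter⁺ (side? c q) uniq)
      nbr λ x∈ y∈ e → triangle-free (nbr x∈) e (nbr y∈))
      where
      sides : ∀ {z} → z ∈ filter (side? c q) H′ → Side c q z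
      sides z∈ = proj₂ (∈-filter⁻ (side? c q) {xs = H′} z∈)
      nbr : ∀ {z} → z ∈ q ∷ filter (side? c q) H′ → c ~ z
      nbr (here refl) = c~q
      nbr (there z∈) = proj₁ (sides z∈)

    -- `v 0` is matched with `a` and `v L` with `x`, each being deleted with its side neighbours. By
    -- `kind` only the interior of the spine is left, and it has an even number of vertices.
    fits-spine : Bounded {σ} H 1 → Fits H (s + (s + 0))
    fits-spine bnd = fits-∖ uniq (v∈ z≤n) (Pendent.mem a-pendent) (here refl)
        (there (∈-filter⁺ (side? (v 0) (v 1)) (Pendent.mem a-pendent)
          (Pendent.link a-pendent , End.x∉ endᵣ (s≤s z≤n))))
        (Pendent.link a-pendent) (side-length uniq v0~v1)
      (fits-∖ uniq₁ (∈-∖⁺ (v∈ ℕ.≤-refl) vL∉) (∈-∖⁺ (Pendent.mem x-pendent) x∉) (here refl)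
        (there (∈-filter⁺ (side? (v L) (v k)) (∈-∖⁺ (Pendent.mem x-pendent) x∉)
          (Pendent.link x-pendent , End.x∉ endᵤ (ℕ.n≤1+n k))))
        (Pendent.link x-pendent) (side-length uniq₁ (~-sym vk~vL))
      (fits-path path l (subst (_≤ L) k≡ (ℕ.n≤1+n k)) (Unique.filter⁺ _ uniq₁)
        (λ 1≤ c≤ → interior∈ 1≤ (subst (_ ≤_) (sym k≡) c≤))
        λ z∈ → let c , 1≤ , c≤ , eq = interior z∈ in c , 1≤ , subst (c ≤_) k≡ c≤ , eq))
      where
      uniq : Unique H
      uniq = Layered.unique σ-layer
      endᵣ : End v L 0 a b
      endᵣ = fork-End path v∈ forkᵣ forkᵤ
      endᵤ : End v L L x y
      endᵤ = fork-End-last path v∈ forkᵣ forkᵤ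
      a-pendent : Pendent H (v 0) a
      a-pendent = Fork.left forkᵣ
      x-pendent : Pendent H (v L) x
      x-pendent = Fork.left forkᵤ
      v0~v1 : v 0 ~ v 1
      v0~v1 = step path (s≤s z≤n)
      vk~vL : v k ~ v L
      vk~vL = step path ℕ.≤-refl
      N₀ X₀ H₁ N₁ X₁ : List V
      N₀ = filter (side? (v 0) (v 1)) H
      X₀ = v 0 ∷ N₀
      H₁ = H ∖ X₀
      N₁ = filter (side? (v L) (v k)) H₁
      X₁ = v L ∷ N₁
      uniq₁ : Unique H₁
      uniq₁ = Unique.filter⁺ _ uniq
      v∉N₀ : ∀ {c} → c ≤ L → v c ∉ N₀
      v∉N₀ {c} c≤ v∈N with _ , e , ne ← ∈-filter⁻ (side? (v 0) (v 1)) {xs = H} v∈N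
        with path-adjacent path z≤n c≤ e
      ... | inj₁ refl = ne refl
      v∉N₁ : ∀ {c} → c ≤ L → v c ∉ N₁
      v∉N₁ {c} c≤ v∈N with _ , e , ne ← ∈-filter⁻ (side? (v L) (v k)) {xs = H₁} v∈N
        with path-adjacent path ℕ.≤-refl c≤ e
      ... | inj₁ refl = ℕ.1+n≰n c≤
      ... | inj₂ refl = ne refl
      v∉X₀ : ∀ {c} → 1 ≤ c → c ≤ L → v c ∉ X₀
      v∉X₀ 1≤ c≤ (here eq) = path-<⇒≢ path 1≤ c≤ (sym eq)
      v∉X₀ 1≤ c≤ (there v∈N) = v∉N₀ c≤ v∈N
      vL∉ : v L ∉ X₀
      vL∉ = v∉X₀ (s≤s z≤n) ℕ.≤-refl
      x∉ : x ∉ X₀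
      x∉ (here eq) = End.x∉ endᵤ z≤n eq
      x∉ (there x∈N) = path-<⇒≢ path (s≤s z≤n) ℕ.≤-refl (Pendent.only x-pendent (v∈ z≤n)
        (proj₁ (proj₂ (∈-filter⁻ (side? (v 0) (v 1)) {xs = H} x∈N))))
      interior∈ : ∀ {c} → 1 ≤ c → c ≤ k → v c ∈ H₁ ∖ X₁
      interior∈ {c} 1≤ c≤ = ∈-∖⁺ (∈-∖⁺ (v∈ c≤L) (v∉X₀ 1≤ c≤L))
        λ { (here eq) → path-<⇒≢ path (s≤s c≤) ℕ.≤-refl eq ; (there v∈N) → v∉N₁ c≤L v∈N }
        where
        c≤L : c ≤ L
        c≤L = ℕ.m≤n⇒m≤1+n c≤
      pathlike : ∀ {z} → z ∈ H₁ ∖ X₁ → Pathlike z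
      pathlike {z} z∈ with z∈₁ , z∉X₁ ← ∈-∖⁻ H₁ X₁ z∈ with z∈H , z∉X₀ ← ∈-∖⁻ H X₀ z∈₁ with kind bnd z∈H
      ... | inj₁ p = p
      ... | inj₂ (inj₁ e) = 1 , s≤s z≤n , decidable-stable (z ≟ v 1)
              λ ne → z∉X₀ (there (∈-filter⁺ (side? (v 0) (v 1)) z∈H (e , ne)))
      ... | inj₂ (inj₂ e) = k , ℕ.n≤1+n k , decidable-stable (z ≟ v k)
              λ ne → z∉X₁ (there (∈-filter⁺ (side? (v L) (v k)) z∈₁ (e , ne)))
      interior : ∀ {z} → z ∈ H₁ ∖ X₁ → ∃ λ c → 1 ≤ c × c ≤ k × z ≡ v c
      interior {z} z∈ with pathlike z∈ | ∈-∖⁻ H₁ X₁ z∈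
      ... | zero , _ , refl | z∈₁ , _ = contradiction (here refl) (proj₂ (∈-∖⁻ H X₀ z∈₁))
      ... | suc c , c≤ , refl | _ , z∉X₁ = suc c , s≤s z≤n ,
              s≤s⁻¹ (ℕ.≤∧≢⇒< c≤ λ { refl → z∉X₁ (here refl) }) , refl
      -- The spine has `k + 2 = 2 * half` vertices, so its interior consists of `half ∸ 1` pairs.
      l : ℕ
      l = half ∸ 1
      k≡ : k ≡ l * 2
      k≡ = trans (cong (_∸ 2) L-odd) (trans (sym (ℕ.*-distribˡ-∸ 2 half 1)) (ℕ.*-comm 2 l))

  -- The bound `s + (s + 0)` is `2 * s` unfolded. Where a single star remains, the cost `suc s` is
  -- within it because `1 ≤ s`.
  fits-whole : Connected G → V → 1 ≤ s → Fits whole (s + (s + 0))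
  fits-whole conn r₀ 1≤s = [ fits-mono small , with-fork ]′ (start conn r₀)
    where
    small : suc s ≤ s + (s + 0)
    small = ℕ.≤-trans (ℕ.+-monoˡ-≤ s 1≤s) (ℕ.+-monoʳ-≤ s (ℕ.m≤m+n s 0))
    module _ (st : Start) where
      open Start st
      module _ {H₁} (red₁ : Reduces ρ H 0 H₁) where
        rooted₁ : Rooted ρ H₁ r a b
        rooted₁ = rooted-reduces rooted red₁
        open Rooted rooted₁
        module _ {u k} (u∈ : u ∈ H₁) (ρu : ρ u ≡ suc k) (star : Star {ρ} H₁ u) where
          open Star star
          g : Geodesic ρ H₁ u (suc k)
          g = geodesic layered u∈ ρu
          open Geodesic g
          r≡ : at 0 ≡ r
          r≡ = geodesic-root rooted₁ g
          -- As roots of `σ`, the four leaves and all `k + 2` vertices of the geodesic are safe from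
          -- deletion.
          R : List V
          R = a ∷ b ∷ x ∷ y ∷ applyUpTo at (suc (suc k))
          path⊆R : ∀ {c} → c ≤ suc k → at c ∈ R
          path⊆R c≤ = there (there (there (there (∈-applyUpTo⁺ at (s≤s c≤)))))
          R⊆ : R ⊆ H₁
          R⊆ (here refl) = Pendent.mem (Fork.left (Rooted.fork rooted₁))
          R⊆ (there (here refl)) = Pendent.mem (Fork.right (Rooted.fork rooted₁))
          R⊆ (there (there (here refl))) = Pendent.mem (Fork.left (Star.fork star))
          R⊆ (there (there (there (here refl)))) = Pendent.mem (Fork.right (Star.fork star))
          R⊆ (there (there (there (there z∈)))) with i , i< , refl ← ∈-applyUpTo⁻ at z∈ = inside (s≤s⁻¹ i<)
          roots⊆R : ∀ {z} → z ∈ r ∷ a ∷ b ∷ [] → z ∈ R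
          roots⊆R (here refl) = subst (_∈ R) r≡ (path⊆R z≤n)
          roots⊆R (there (here refl)) = here refl
          roots⊆R (there (there (here refl))) = there (here refl)
          -- All vertices of `ρ`-rank 0 lie in `R`, so chains of `ρ`-parents connect `H₁` to `R`.
          open Ranking (ranking (Layered.unique layered) R⊆ λ {z} z∈ →
            walk-from-roots layered {R} (λ z∈ ρz → 0 , roots⊆R (roots z∈ ρz)) (ρ z) z∈ refl)
            renaming (ρ to σ; layered to σ-layered)
          module _ {H₂} (red₂ : Reduces σ H₁ 0 H₂) where
            open Reduces red₂ renaming (layered to σ-layered₂; cost to cost₂)
            R∈ : ∀ {z} → z ∈ R → z ∈ H₂
            R∈ z∈ = keep (R⊆ z∈) (root⇒0 z∈)
            forkᵣ : Fork H₂ (at 0) a b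
            forkᵣ = subst (λ z → Fork H₂ z a b) (sym r≡)
              (Fork-⊆ sub (R∈ (here refl)) (R∈ (there (here refl))) (Rooted.fork rooted₁))
            forkᵤ : Fork H₂ (at (suc k)) x y
            forkᵤ = subst (λ z → Fork H₂ z x y) (sym at-end)
              (Fork-⊆ sub (R∈ (there (there (here refl)))) (R∈ (there (there (there (here refl))))) (Star.fork star))
            σ-roots : ∀ {z} → z ∈ R →
              (∃ λ c → c ≤ suc k × z ≡ at c) ⊎ Pendent H₂ (at 0) z ⊎ Pendent H₂ (at (suc k)) z
            σ-roots (here refl) = inj₂ (inj₁ (Fork.left forkᵣ))
            σ-roots (there (here refl)) = inj₂ (inj₁ (Fork.right forkᵣ))
            σ-roots (there (there (here refl))) = inj₂ (inj₂ (Fork.left forkᵤ))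
            σ-roots (there (there (there (here refl)))) = inj₂ (inj₂ (Fork.right forkᵤ))
            σ-roots (there (there (there (there z∈)))) with i , i< , refl ← ∈-applyUpTo⁻ at z∈ =
              inj₁ (i , s≤s⁻¹ i< , refl)
            spine : Spine H₂
            spine = record
              { ρ = ρ ; σ = σ ; v = at ; k = k
              ; path = path
              ; v∈ = λ c≤ → R∈ (path⊆R c≤)
              ; ρv = rank
              ; forkᵣ = forkᵣ
              ; forkᵤ = forkᵤ
              ; ρ-lip = λ x∈ y∈ → Layered.lipschitz layered (sub x∈) (sub y∈)
              ; σ-layer = σ-layered₂
              ; σv = λ c≤ → root⇒0 (path⊆R c≤)
              ; σ-roots = λ z∈ σz → σ-roots (0⇒root (sub z∈) σz) }
            fits₂ : Bounded {σ} H₂ 1 ⊎ (∃ λ u → u ∈ H₂ × 1 ≤ σ u × Star {σ} H₂ u) → Fits H₂ (s + (s + 0))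
            fits₂ (inj₁ bnd) = OnSpine.fits-spine spine bnd
            fits₂ (inj₂ (_ , u∈ , 1≤ , st)) = ⊥-elim (OnSpine.third-star spine u∈ 1≤ st)
          fits₁ : Fits H₁ (s + (s + 0))
          fits₁ = let K , K-bound = bounded σ H₁
                      _ , red₂ , outcome = descend K (s≤s z≤n) σ-layered λ v∈ → ℕ.≤-trans (K-bound v∈) (ℕ.m≤m+n K 1)
                  in Reduces.cost red₂ (fits₂ red₂ outcome)
        fits-H₁ : Bounded {ρ} H₁ 1 ⊎ (∃ λ u → u ∈ H₁ × 1 ≤ ρ u × Star {ρ} H₁ u) → Fits H₁ (s + (s + 0))
        fits-H₁ (inj₁ bnd) = fits-mono small (fits-bounded layered bnd r∈ ρr root-or-pendent)
        fits-H₁ (inj₂ (u , u∈ , 1≤ , star)) = at-rank (ρ u) refl 1≤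
          where
          at-rank : ∀ k → ρ u ≡ k → 1 ≤ k → Fits H₁ (s + (s + 0))
          at-rank (suc k) ρu _ = fits₁ u∈ ρu star
      with-fork : Fits whole (s + (s + 0))
      with-fork = let K , K-bound = bounded ρ H
                      _ , red₁ , outcome = descend K (s≤s z≤n) (Rooted.layered rooted) λ v∈ → ℕ.≤-trans (K-bound v∈) (ℕ.m≤m+n K 1)
                  in cost (Reduces.cost red₁ (fits-H₁ red₁ outcome))

-- From matchings to the deficiency.

module Deficiency (G : Graph) where
  open Ranks G

  fits⇒DefAtMost : ∀ {c} → Fits (allFin (n G)) c → DefAtMost G c
  fits⇒DefAtMost {c} (M′ , matching , _ , le) M (_ , maximum) = ℕ.m≤n+o⇒m∸n≤o (n G) (2 * length M)
    (ℕ.≤-trans (subst (_≤ 2 * length M′ + c) (List.length-tabulate (λ i → i)) le)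
      (ℕ.+-monoˡ-≤ c (ℕ.*-monoʳ-≤ 2 (maximum M′ matching))))

  -- The constructions start from some vertex as root; a graph without vertices is settled by the
  -- empty matching.
  fits-inhabited : ∀ {c} → (V → Fits (allFin (n G)) c) → Fits (allFin (n G)) c
  fits-inhabited {c} fits with any? {n = n G} (λ v → v ∈? allFin (n G))
  ... | yes (v , _) = fits v
  ... | no none = fits-empty (ℕ.≤-trans (empty-length λ v∈ → none (_ , v∈)) z≤n)

theorem1p9 : ((m t p : ℕ) (G : Graph) → 3 < m → 3 < t → 1 ≤ p →
    InFamily (λ i → i ≡ 2 * p) G →
    ¬ InducedCopy G (suc t) (star t) → ¬ HasClique G m →
    DefAtMost G ((m ∸ 1) * (t ∸ 3) + 1))
    ×
    ((t : ℕ) (G : Graph) → 3 < t →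
    InFamily (λ i → 1 ≤ i × ∃ λ k → i ≡ 2 * k) G →
    ¬ InducedCopy G (suc t) (star t) → ¬ HasClique G 3 →
    DefAtMost G (2 * t ∸ 6))
theorem1p9 = one-length , even-lengths
  where
  one-length : (m t p : ℕ) (G : Graph) → 3 < m → 3 < t → 1 ≤ p →
    InFamily (λ i → i ≡ 2 * p) G →
    ¬ InducedCopy G (suc t) (star t) → ¬ HasClique G m →
    DefAtMost G ((m ∸ 1) * (t ∸ 3) + 1)
  one-length (suc (suc m)) (suc (suc (suc s))) (suc p) G _ _ _ (conn , family) star-free clique-free =
    fits⇒DefAtMost (fits-inhabited λ r → OneLength.fits-whole G {s} star-free p family {m} conn r clique-free)
    where open Deficiency G
  one-length 1 _ _ _ (s≤s ())
  one-length _ 1 _ _ _ (s≤s ())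
  one-length _ 2 _ _ _ (s≤s (s≤s ()))

  even-lengths : (t : ℕ) (G : Graph) → 3 < t →
    InFamily (λ i → 1 ≤ i × ∃ λ k → i ≡ 2 * k) G →
    ¬ InducedCopy G (suc t) (star t) → ¬ HasClique G 3 →
    DefAtMost G (2 * t ∸ 6)
  even-lengths (suc (suc (suc s))) G (s≤s (s≤s (s≤s 1≤s))) (conn , family) star-free triangle-free =
    subst (DefAtMost G) (sym bound) (fits⇒DefAtMost (fits-inhabited λ r →
      EvenLengths.fits-whole G {s} star-free (λ i 2≤ copy → proj₂ (family i 2≤ copy)) triangle-free conn r 1≤s))
    where
    open Deficiency G
    open +-*-Solver
    bound : 2 * (3 + s) ∸ 6 ≡ s + (s + 0)
    bound = trans (cong (_∸ 6) (solve 1 (λ s → con 2 :* (con 3 :+ s) := con 6 :+ (s :+ (s :+ con 0))) refl s))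
      (ℕ.m+n∸m≡n 6 (s + (s + 0)))
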